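{- Let $\mathcal{G}_1,\mathcal{G}_2$ be two directed mixed graphs (DMGs) with the same nodes $\mathcal{V}^+=\mathcal{V}\cup\mathcal{S}$ (with $\mathcal V$ and $\mathcal S$ disjoint), and let $\mathcal{H}_1,\mathcal{H}_2$ be two $\sigma$-MAGs with nodes $\mathcal V$ that represent $\mathcal{G}_1,\mathcal{G}_2$ given $\mathcal{S}$, respectively. Then $\mathcal{G}_1,\mathcal{G}_2$ are $\sigma$-Markov equivalent given $\mathcal{S}$ if and only if all of the following three conditions hold: (1) $\mathcal{H}_1,\mathcal{H}_2$ have the same adjacencies. (2) $\mathcal{H}_1,\mathcal{H}_2$ have the same unshielded colliders. (3) Whenever $\pi$ is a discriminating path for a node $v$ in $\mathcal{H}_1$ and the corresponding path $\pi'$ in $\mathcal{H}_2$ (the path with the same sequence of nodes) is also a discriminating path for $v$, then $v$ is a collider on $\pi$ in $\mathcal{H}_1$ if and only if $v$ is a collider on $\pi'$ in $\mathcal{H}_2$.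
   Context: **Mixed graphs.** A mixed graph $\mathcal{H}=(\mathcal{V},\mathcal{E})$ has nodes $\mathcal{V}$ and edges between nodes of the types $\rightarrow,\leftarrow,\leftrightarrow,-$ ($a\rightarrow b$ is the same as $b\leftarrow a$; $\leftrightarrow$ and $-$ are symmetric). Each edge has a mark (tail or arrowhead) at each end; $*$ stands for either mark: $a\mathrel{*\!\!\rightarrow} b$ (equivalently $b\mathrel{\leftarrow\!\!*}a$) means $a\rightarrow b$ or $a\leftrightarrow b$ (the edge is into $b$); $a\mathrel{ -\!\!*}b$ means $a\rightarrow b$ or $a-b$ (the edge is out of $a$). Two nodes are adjacent if there is an edge between them. A walk between $v_0$ and $v_n$ ($n\ge 0$) is an alternating sequence $v_0,e_1,v_1,\dots,e_n,v_n$ with $e_i$ an edge between $v_{i-1}$ and $v_i$; it is a path if no node occurs more than once. It is a directed walk (path) from $v_0$ to $v_n$ if $e_i$ is $v_{i-1}\rightarrow v_i$ for all $i$, and an anterior walk (path) from $v_0$ to $v_n$ if $e_i$ is $v_{i-1}\mathrel{ -\!\!*}v_i$ for all $i$. $\mathrm{Anc}_{\mathcal H}(b)$ is the set of nodes from which there is a directed walk to $b$ (so $b\in\mathrm{Anc}_{\mathcal H}(b)$), and $\mathrm{Anc}_{\mathcal H}(A)=\bigcup_{v\in A}\mathrm{Anc}_{\mathcal H}(v)$. A non-endpoint $v_k$ of a walk is a collider on it if both adjacent edges on the walk have an arrowhead at $v_k$; all other nodes on the walk, including endpoints, are non-colliders. An inducing path is a path between $v_0$ and $v_n$ on which every non-endpoint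 node is a collider and belongs to $\mathrm{Anc}_{\mathcal H}(\{v_0,v_n\})$. **$\sigma$-MAG.** A mixed graph $\mathcal H$ is a $\sigma$-MAG if: (1) between any two distinct nodes there is at most one edge, and no node is adjacent to itself; (2) (ancestral) if $\mathcal H$ contains an anterior path from $a$ to $b$, then it contains no edge $a\mathrel{\leftarrow\!\!*}b$; (3a) (maximal) there is no inducing path between any two distinct non-adjacent nodes; (3b) ($\sigma$-complete) if $\mathcal H$ contains $a\mathrel{*\!\!\rightarrow}b$ and $b-c$, then $a$ and $c$ are adjacent; and if moreover $\mathcal H$ contains $b-d$ with $d\ne c$, then $c$ and $d$ are adjacent. **Unshielded colliders, discriminating paths.** A triple of distinct nodes $(a,b,c)$ is unshielded if $b$ is adjacent to both $a$ and $c$ but $a$ is not adjacent to $c$; it is an unshielded collider if in addition $a\mathrel{*\!\!\rightarrow}b\mathrel{\leftarrow\!\!*}c$. A path $\pi=(a,v_0,\dots,v_n,b,c)$ with $n\ge0$ in $\mathcal H$ is a discriminating path for $b$ if $a$ is not adjacent to $c$ in $\mathcal H$, and for each $k=0,\dots,n$, $v_k$ is a collider on $\pi$ and $v_k\rightarrow c$ in $\mathcal H$. **DMGs.** A DMG $\mathcal G$ has a node set, directed edges $u\rightarrow v$ and bidirected (symmetric) edges $u\leftrightarrow v$ between distinct nodes; at most one edge of each of the types $u\rightarrow v$, $v\rightarrow u$, $u\leftrightarrow v$ between each pair (several types may coexist), no self-loops. Walks, paths, $\mathrm{Anc}_{\mathcal G}$, colliders and non-colliders are defined as for mixed graphs.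 $\mathrm{Sc}_{\mathcal G}(v)$ is the strongly connected component of $v$: all $w$ with $w\in\mathrm{Anc}_{\mathcal G}(v)$ and $v\in\mathrm{Anc}_{\mathcal G}(w)$. A non-collider $v_k$ on a walk is unblockable if it is not an endpoint and every directed edge on the walk going out of $v_k$ to a neighbouring node $v_{k\pm1}$ on the walk satisfies $v_{k\pm1}\in\mathrm{Sc}_{\mathcal G}(v_k)$; otherwise (in particular if it is an endpoint) it is blockable. For distinct $v_i,v_j\in\mathcal V$, a path (walk) in $\mathcal G$ between $v_i$ and $v_j$ is $\sigma$-inducing given $\mathcal S$ if each collider on it is in $\mathrm{Anc}_{\mathcal G}(\{v_i,v_j\}\cup\mathcal S)$ and each non-endpoint non-collider on it is unblockable. **$\sigma$-separation and $\sigma$-Markov equivalence.** For a set $W$ of nodes of a DMG $\mathcal G$, a walk in $\mathcal G$ is $W$-$\sigma$-open if all colliders on it are in $\mathrm{Anc}_{\mathcal G}(W)$ and no blockable non-collider on it is in $W$; otherwise it is $W$-$\sigma$-blocked. $X$ is $\sigma$-separated from $Y$ given $W$ in $\mathcal G$ if every walk from a node in $X$ to a node in $Y$ is $W$-$\sigma$-blocked. Two DMGs $\mathcal G_1,\mathcal G_2$ with nodes $\mathcal V\cup\mathcal S$ are $\sigma$-Markov equivalent given $\mathcal S$ if for all $X,Y,Z\subseteq\mathcal V$: $X$ is $\sigma$-separated from $Y$ given $Z\cup\mathcal S$ in $\mathcal G_1$ if and only if this holds in $\mathcal G_2$. **Representation.** Let $\mathcal G$ be a DMG with nodes $\mathcal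 V\cup\mathcal S$. The mixed graph $\mathcal H$ with nodes $\mathcal V$ represents $\mathcal G$ given $\mathcal S$ if: (1) in $\mathcal H$ there is at most one edge between any two distinct nodes and no edge from a node to itself; (2) distinct $a,b\in\mathcal V$ are adjacent in $\mathcal H$ if and only if there is a $\sigma$-inducing path between $a$ and $b$ given $\mathcal S$ in $\mathcal G$; (3) if $a\mathrel{\leftarrow\!\!*}b$ in $\mathcal H$ then $a\notin\mathrm{Anc}_{\mathcal G}(\{b\}\cup\mathcal S)$; (4) if $a\mathrel{ -\!\!*}b$ in $\mathcal H$ then $a\in\mathrm{Anc}_{\mathcal G}(\{b\}\cup\mathcal S)$. -}

module Defs where

open import Data.List using (List; []; _∷_; _++_)
open import Data.List.NonEmpty using (List⁺; toList)
open import Data.List.Membership.Propositional using () renaming (_∈_ to _∈ˡ_)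
open import Data.List.Relation.Unary.Unique.Propositional using (Unique)
open import Data.Product using (Σ; ∃-syntax; _×_; _,_)
open import Data.Sum using (_⊎_; inj₁; [_,_])
open import Function.Bundles using (_⇔_)
open import Level using (0ℓ)
open import Relation.Binary.Core using (Rel)
open import Relation.Binary.Construct.Closure.ReflexiveTransitive using (Star; ε; _◅_)
open import Relation.Binary.PropositionalEquality using (_≡_; _≢_)
open import Relation.Nullary using (¬_)
open import Relation.Unary using (Pred; _∈_; _∉_; _∪_; ∅; U; ｛_｝)

data Mark : Set where
  tail arrowhead : Mark

-- E a m n b: there is an edge between a and b with mark m at a and mark n at b.
-- Thus a → b is E a tail arrowhead b, a ↔ b is E a arrowhead arrowhead b, and
-- a - b is E a tail tail b.  E only records whether an edge of a given type is
-- present: proofs of the same instance are never compared, so there is at most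
-- one edge of each type between two nodes.
record MixedGraph (V : Set) : Set₁ where
  field
    E    : V → Mark → Mark → V → Set
    flip : ∀ {a m n b} → E a m n b → E b n m a

record DMG (N : Set) : Set₁ where
  field
    graph        : MixedGraph N
  open MixedGraph graph public
  field
    noUndirected : ∀ {a b} → ¬ E a tail tail b
    noLoop       : ∀ {a m n} → ¬ E a m n a

-- The sequence of nodes visited by a walk with steps in an arbitrary relation.
nodes : ∀ {V : Set} {R : Rel V 0ℓ} {a b} → Star R a b → List V
nodes {a = a} ε       = a ∷ []
nodes {a = a} (_ ◅ w) = a ∷ nodes w

IsPath : ∀ {V : Set} {R : Rel V 0ℓ} {a b} → Star R a b → Set
IsPath w = Unique (nodes w)

-- Passes w e f: the walk w traverses e and, immediately afterwards, f.  So the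
-- proofs of Passes w e f, for varying e and f, are the non-endpoint positions
-- on w; positions, not nodes, are (non-)colliders, as a node may recur on w.
data Passes {V : Set} {R : Rel V 0ℓ} :
     ∀ {a b u v w} → Star R a b → R u v → R v w → Set where
  here  : ∀ {a b c d} {e : R a b} {f : R b c} {π : Star R c d} →
          Passes (e ◅ f ◅ π) e f
  there : ∀ {a b c u v w} {g : R a b} {π : Star R b c} {e : R u v} {f : R v w} →
          Passes π e f → Passes (g ◅ π) e f

module _ {V : Set} (H : MixedGraph V) where
  open MixedGraph H

  record Edge (a b : V) : Set where
    constructor edge
    field
      {markˡ markʳ} : Mark
      present       : E a markˡ markʳ b

  Adjacent : V → V → Set
  Adjacent = Edge

  Directed Undirected Into OutOf : V → V → Set
  Directed   a b = E a tail arrowhead b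
  Undirected a b = E a tail tail b
  -- a *→ b
  Into       a b = ∃[ m ] E a m arrowhead b
  -- a -* b
  OutOf      a b = ∃[ n ] E a tail n b

  Walk DirectedWalk AnteriorWalk : V → V → Set
  Walk         = Star Edge
  DirectedWalk = Star Directed
  AnteriorWalk = Star OutOf

  -- a ∈ Anc b, respectively a ∈ AncSet A
  Anc : V → Pred V 0ℓ
  Anc b a = DirectedWalk a b

  AncSet : Pred V 0ℓ → Pred V 0ℓ
  AncSet A a = ∃[ v ] v ∈ A × a ∈ Anc v

  Collider : ∀ {u v w} → Edge u v → Edge v w → Set
  Collider e f = Edge.markʳ e ≡ arrowhead × Edge.markˡ f ≡ arrowhead

  IsColliderOn : ∀ {a b} → V → Walk a b → Set
  IsColliderOn v π = ∃[ u ] ∃[ w ] Σ (Edge u v) λ e → Σ (Edge v w) λ f →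
                     Passes π e f × Collider e f

  record IsInducingPath {a b} (π : Walk a b) : Set where
    field
      isPath    : IsPath π
      colliders : ∀ {u v w} {e : Edge u v} {f : Edge v w} → Passes π e f →
                  Collider e f × v ∈ AncSet (｛ a ｝ ∪ ｛ b ｝)

  record IsSimple : Set where
    field
      unique : ∀ {a b m n m′ n′} → a ≢ b →
               E a m n b → E a m′ n′ b → m ≡ m′ × n ≡ n′
      noLoop : ∀ {a} → ¬ Adjacent a a

  record IsσMAG : Set where
    field
      simple    : IsSimple
      ancestral : ∀ {a b} → Σ (AnteriorWalk a b) IsPath → ¬ Into b a
      maximal   : ∀ {a b} → a ≢ b → ¬ Adjacent a b →
                  ¬ (Σ (Walk a b) IsInducingPath)
      complete₁ : ∀ {a b c} → Into a b → Undirected b c → Adjacent a c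
      complete₂ : ∀ {a b c d} → Into a b → Undirected b c →
                  Undirected b d → d ≢ c → Adjacent c d

  record UnshieldedTriple (a b c : V) : Set where
    field
      a≢b  : a ≢ b
      b≢c  : b ≢ c
      a≢c  : a ≢ c
      adjˡ : Adjacent a b
      adjʳ : Adjacent b c
      ¬adj : ¬ Adjacent a c

  UnshieldedCollider : V → V → V → Set
  UnshieldedCollider a b c = UnshieldedTriple a b c × Into a b × Into c b

  record IsDiscriminatingPath (b : V) {a c} (π : Walk a c) : Set where
    field
      isPath    : IsPath π
      vs        : List⁺ V
      shape     : nodes π ≡ a ∷ toList vs ++ b ∷ c ∷ []
      ¬adj      : ¬ Adjacent a c
      colliders : ∀ v → v ∈ˡ toList vs → IsColliderOn v π × Directed v c

module _ {V : Set} (H₁ H₂ : MixedGraph V) where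

  SameAdjacencies : Set
  SameAdjacencies = ∀ a b → Adjacent H₁ a b ⇔ Adjacent H₂ a b

  SameUnshieldedColliders : Set
  SameUnshieldedColliders =
    ∀ a b c → UnshieldedCollider H₁ a b c ⇔ UnshieldedCollider H₂ a b c

  SameDiscriminatedColliders : Set
  SameDiscriminatedColliders =
    ∀ {a c} v (π : Walk H₁ a c) (π′ : Walk H₂ a c) → nodes π ≡ nodes π′ →
    IsDiscriminatingPath H₁ v π → IsDiscriminatingPath H₂ v π′ →
    IsColliderOn H₁ v π ⇔ IsColliderOn H₂ v π′

module _ {N : Set} (G : DMG N) where
  private
    g : MixedGraph N
    g = DMG.graph G

  Sc : N → Pred N 0ℓ
  Sc v w = w ∈ Anc g v × v ∈ Anc g w

  -- For a non-endpoint position; endpoints are never unblockable.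
  record UnblockableNonCollider {u v w} (e : Edge g u v) (f : Edge g v w) : Set where
    field
      ¬collider : ¬ Collider g e f
      backward  : Edge.markˡ e ≡ arrowhead → Edge.markʳ e ≡ tail → u ∈ Sc v
      forward   : Edge.markˡ f ≡ tail → Edge.markʳ f ≡ arrowhead → w ∈ Sc v

  data BlockableNonColliderOn {a b} (π : Walk g a b) : Pred N 0ℓ where
    start : BlockableNonColliderOn π a
    end   : BlockableNonColliderOn π b
    inner : ∀ {u v w} {e : Edge g u v} {f : Edge g v w} → Passes π e f →
            ¬ Collider g e f → ¬ UnblockableNonCollider e f →
            BlockableNonColliderOn π v

  record IsσInducingPath (S : Pred N 0ℓ) {a b} (π : Walk g a b) : Set where
    field
      isPath       : IsPath π
      colliders    : ∀ {u v w} {e : Edge g u v} {f : Edge g v w} → Passes π e f →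
                     Collider g e f → v ∈ AncSet g ((｛ a ｝ ∪ ｛ b ｝) ∪ S)
      nonColliders : ∀ {u v w} {e : Edge g u v} {f : Edge g v w} → Passes π e f →
                     ¬ Collider g e f → UnblockableNonCollider e f

  record IsσOpen (W : Pred N 0ℓ) {a b} (π : Walk g a b) : Set where
    field
      colliders    : ∀ {u v w} {e : Edge g u v} {f : Edge g v w} → Passes π e f →
                     Collider g e f → v ∈ AncSet g W
      nonColliders : ∀ {v} → BlockableNonColliderOn π v → v ∉ W

  σSeparated : (X Y W : Pred N 0ℓ) → Set
  σSeparated X Y W = ∀ {x y} → x ∈ X → y ∈ Y → (π : Walk g x y) → ¬ IsσOpen W π

-- A DMG with nodes 𝒱 ∪ 𝒮, the two being disjoint, is a DMG (V ⊎ S).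
module _ {V S : Set} where

  -- A subset of 𝒱, as a subset of 𝒱 ∪ 𝒮.
  embed : Pred V 0ℓ → Pred (V ⊎ S) 0ℓ
  embed X = [ X , ∅ ]

  -- The subset 𝒮 of 𝒱 ∪ 𝒮.
  𝒮 : Pred (V ⊎ S) 0ℓ
  𝒮 = [ ∅ , U ]

  σMarkovEquivalent : DMG (V ⊎ S) → DMG (V ⊎ S) → Set₁
  σMarkovEquivalent G₁ G₂ =
    ∀ (X Y Z : Pred V 0ℓ) →
    σSeparated G₁ (embed X) (embed Y) (embed Z ∪ 𝒮) ⇔
    σSeparated G₂ (embed X) (embed Y) (embed Z ∪ 𝒮)

  record Represents (H : MixedGraph V) (G : DMG (V ⊎ S)) : Set where
    private
      g : MixedGraph (V ⊎ S)
      g = DMG.graph G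
    field
      simple      : IsSimple H
      adjacencies : ∀ {a b} → a ≢ b →
                    Adjacent H a b ⇔
                    Σ (Walk g (inj₁ a) (inj₁ b)) (IsσInducingPath G 𝒮)
      arrowheads  : ∀ {a b} → Into H b a → inj₁ a ∉ AncSet g (｛ inj₁ b ｝ ∪ 𝒮)
      tails       : ∀ {a b} → OutOf H a b → inj₁ a ∈ AncSet g (｛ inj₁ b ｝ ∪ 𝒮)

{-# OPTIONS --safe #-}
module Submission where

-- Two local descriptions replace σ-open walks.  In G, a position on a walk whose
-- outgoing edges stay in its strongly connected component can be passed whether or
-- not it is conditioned on, and colliders only have to be ancestors of the
-- endpoints and of W = Z ∪ S; such a walk exists iff a σ-open one does.  In H,
-- the edges must have arrowheads at the nodes of Z, and nodes with an arrowhead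
-- must be anterior to Z or to an endpoint.  The two kinds of walks correspond:
-- edges of H expand to inducing paths, and a walk in G with as few marked nodes of V
-- as possible yields one in H.
--
-- (⇒) If a and c are not adjacent in H₂, their ancestors separate them in G₂, so no
-- collider path of H₁ inside that set can join them.
--
-- (⇐) Take a shortest open walk in H₁, with its colliders as close to Z and the
-- endpoints as possible.  At each of its positions there is an unshielded triple or
-- a discriminating path, extending along the walk to the left or to the right.
-- Hence the collider status of a position is determined by the positions on one
-- side; by maximality two positions never determine each other, so all statuses
-- agree in H₁ and H₂.  The same argument, applied to the first edge of a shortest
-- anterior walk from a collider, shows that the colliders are still anterior to Z
-- or to an endpoint in H₂.

open import Defs
open import Axiom.ExcludedMiddle using (ExcludedMiddle)
open import Data.Empty using (⊥; ⊥-elim)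
open import Data.List using (List; []; _∷_; _++_)
open import Data.List.NonEmpty using (List⁺; toList)
open import Data.List.Membership.Propositional.Properties using (∈-++⁻; ∈-++⁺ʳ)
open import Data.List.Properties using (∷-injectiveʳ; ++-assoc; ++-cancelʳ)
open import Data.List.Membership.Propositional using () renaming (_∈_ to _∈ˡ_)
open import Data.List.Relation.Unary.All as All using (All; []; _∷_; lookup)
open import Data.List.Relation.Unary.All.Properties using (¬Any⇒All¬)
open import Data.List.Relation.Unary.AllPairs using ([]; _∷_)
open import Data.List.Relation.Unary.Unique.Propositional using (Unique)
open import Data.List.Relation.Unary.Any using (here; there)
open import Data.Nat using (ℕ; zero; suc; pred; _+_; _∸_; _≤_; _<_; z≤n; s≤s; s≤s⁻¹;
  _≤′_; ≤′-refl; ≤′-step)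
open import Data.Nat.Induction using (<-wellFounded)
open import Data.Nat.Properties
import Data.Product as Product
open import Data.Product using (Σ; ∃; ∃-syntax; _×_; _,_; proj₁; proj₂; map₂)
import Data.Sum as Sum
open import Data.Sum using (_⊎_; inj₁; inj₂; [_,_]′)
open import Data.Unit using (⊤; tt)
open import Function using (id; _∘_; case_of_)
open import Function.Bundles using (_⇔_; mk⇔; Equivalence)
open import Function.Construct.Symmetry using (⇔-sym)
open import Induction.WellFounded using (Acc; acc)
open import Level using (0ℓ)
open import Relation.Binary.Core using (Rel)
open import Relation.Binary.Construct.Closure.ReflexiveTransitive
  using (Star; ε; _◅_; _◅◅_; map; kleisliStar)
open import Relation.Binary.PropositionalEquality
  using (_≡_; _≢_; refl; sym; trans; cong; subst; subst₂)
open import Relation.Nullary using (¬_; Dec; yes; no; contradiction)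
open import Relation.Nullary.Decidable using (decidable-stable)
open import Relation.Unary using (Pred; _∈_; _∉_; _∪_; _⊆_; ∁; ｛_｝)

-- Nodes and positions of walks

nodes-map : ∀ {V : Set} {R Q : Rel V 0ℓ} (f : ∀ {u v} → R u v → Q u v)
  {a b} (w : Star R a b) → nodes (map f w) ≡ nodes w
nodes-map f ε       = refl
nodes-map f (_ ◅ w) = cong (_ ∷_) (nodes-map f w)

module _ {V : Set} {R : Rel V 0ℓ} where

  end∈nodes : ∀ {a b} (w : Star R a b) → b ∈ˡ nodes w
  end∈nodes ε       = here refl
  end∈nodes (_ ◅ w) = there (end∈nodes w)

  middle∈tail : ∀ {a b c u v w} {g : R a b} {π : Star R b c} {e : R u v} {f : R v w} →
    Passes (g ◅ π) e f → v ∈ˡ nodes π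
  middle∈tail here                      = here refl
  middle∈tail {π = _ ◅ _} (there p) = there (middle∈tail p)

  middle∈nodes : ∀ {a b u v w} {π : Star R a b} {e : R u v} {f : R v w} →
    Passes π e f → v ∈ˡ nodes π
  middle∈nodes p@here      = there (middle∈tail p)
  middle∈nodes p@(there _) = there (middle∈tail p)

  middle≢start : ∀ {a b u v w} {π : Star R a b} {e : R u v} {f : R v w} →
    IsPath π → Passes π e f → a ≢ v
  middle≢start (a∉ ∷ _) p@here      = lookup a∉ (middle∈tail p)
  middle≢start (a∉ ∷ _) p@(there _) = lookup a∉ (middle∈tail p)

  middle≢end : ∀ {a b u v w} {π : Star R a b} {e : R u v} {f : R v w} →
    IsPath π → Passes π e f → v ≢ b
  middle≢end (_ ∷ v∉ ∷ _) (here {π = π}) = lookup v∉ (end∈nodes π)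
  middle≢end (_ ∷ uniq)   (there p)      = middle≢end uniq p

  -- No node recurs on a path, so the position that `IsColliderOn` asserts is the only one at its
  -- node.
  neighbours-unique : ∀ {a b u v w u′ w′} {π : Star R a b}
    {e : R u v} {f : R v w} {e′ : R u′ v} {f′ : R v w′} →
    IsPath π → Passes π e f → Passes π e′ f′ → u ≡ u′ × w ≡ w′
  neighbours-unique _          here      here      = refl , refl
  neighbours-unique (_ ∷ uniq) here      (there q) = contradiction refl (middle≢start uniq q)
  neighbours-unique (_ ∷ uniq) (there p) here      = contradiction refl (middle≢start uniq p)
  neighbours-unique (_ ∷ uniq) (there p) (there q) = neighbours-unique uniq p q

  nodes⇒passes : ∀ {a b u v w} (π : Star R a b) xs {ys} →
    nodes π ≡ xs ++ u ∷ v ∷ w ∷ ys →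
    Σ (R u v) λ e → Σ (R v w) λ f → Passes π e f
  nodes⇒passes (e ◅ f ◅ ε)     []       refl = e , f , here
  nodes⇒passes (e ◅ f ◅ _ ◅ _) []       refl = e , f , here
  nodes⇒passes ε               (_ ∷ []) ()
  nodes⇒passes ε               (_ ∷ _ ∷ _) ()
  nodes⇒passes (_ ◅ π)         (_ ∷ xs) eq with nodes⇒passes π xs (∷-injectiveʳ eq)
  ... | e , f , p = e , f , there p

  length : ∀ {a b} → Star R a b → ℕ
  length ε       = 0
  length (_ ◅ w) = suc (length w)

  length-◅◅ : ∀ {a b c} (w : Star R a b) (w′ : Star R b c) →
    length (w ◅◅ w′) ≡ length w + length w′
  length-◅◅ ε       w′ = refl
  length-◅◅ (_ ◅ w) w′ = cong suc (length-◅◅ w w′)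

  unsnoc : ∀ {a b c} (e : R a b) (w : Star R b c) →
    ∃[ d ] Σ (Star R a d) λ w′ → R d c × length w′ ≡ length w
  unsnoc e ε = _ , ε , e , refl
  unsnoc e (f ◅ w) with unsnoc f w
  ... | d , w′ , g , eq = d , e ◅ w′ , g , cong suc eq

-- Minima and removal of loops

module Classical (em : ExcludedMiddle 0ℓ) where

  least : {P : ℕ → Set} → ∃ P → ∃[ n ] P n × (∀ {k} → P k → n ≤ k)
  least {P} (n , p) = go (<-wellFounded n) p
    where
    go : ∀ {n} → Acc _<_ n → P n → ∃[ n ] P n × (∀ {k} → P k → n ≤ k)
    go {n} (acc rs) p with em {∃[ k ] k < n × P k}
    ... | yes (k , k<n , q) = go (rs k<n) q
    ... | no ¬smaller       = n , p , λ q → ≮⇒≥ λ k<n → ¬smaller (_ , k<n , q)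

  suffix : ∀ {V : Set} {R : Rel V 0ℓ} {a b c} (w : Star R b c) → IsPath w →
    a ∈ˡ nodes w → Σ (Star R a c) IsPath
  suffix ε       uniq       (here refl) = ε , uniq
  suffix (e ◅ w) uniq       (here refl) = e ◅ w , uniq
  suffix (_ ◅ w) (_ ∷ uniq) (there a∈)  = suffix w uniq a∈

  toPath : ∀ {V : Set} {R : Rel V 0ℓ} {a b} → Star R a b → Σ (Star R a b) IsPath
  toPath ε = ε , [] ∷ []
  toPath {a = a} (e ◅ w) with toPath w
  ... | w′ , uniq with em {a ∈ˡ nodes w′}
  ...   | yes a∈ = suffix w′ uniq a∈
  ...   | no  a∉ = e ◅ w′ , ¬Any⇒All¬ _ a∉ ∷ uniq

-- σ-open walks and σ-inducing paths as nice walks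

-- A position v of a walk in G at which every outgoing edge of the walk stays in
-- Sc(v) is a collider or unblockable, and conversely.  This splits the condition
-- on a position into two conditions on single edges, so that it survives any
-- cutting and pasting of walks.
module _ {N : Set} (G : DMG N) where
  open DMG G
  private
    g : MixedGraph N
    g = graph

  StaysInScˡ StaysInScʳ : ∀ {u v} → Edge g u v → Set
  StaysInScˡ {u} {v} e = Edge.markˡ e ≡ tail → Edge.markʳ e ≡ arrowhead → v ∈ Sc G u
  StaysInScʳ {u} {v} e = Edge.markˡ e ≡ arrowhead → Edge.markʳ e ≡ tail → u ∈ Sc G v

  -- `P` collects the nodes at which the walk must not leave the component, `A` the nodes it may
  -- visit. For σ-inducing paths `P` is the complement of the endpoints, for σ-open walks the
  -- conditioning set.
  record NiceEdge (P A : Pred N 0ℓ) (u v : N) : Set where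
    constructor nice
    field
      nice-edge : Edge g u v
      stayˡ     : u ∈ P → StaysInScˡ nice-edge
      stayʳ     : v ∈ P → StaysInScʳ nice-edge
      inˡ       : u ∈ A
      inʳ       : v ∈ A

  open NiceEdge public

  NiceWalk : (P A : Pred N 0ℓ) → N → N → Set
  NiceWalk P A = Star (NiceEdge P A)

  relax : ∀ {P Q A B : Pred N 0ℓ} → (∀ {n} → n ∈ A → n ∈ Q → n ∈ P) → A ⊆ B →
    ∀ {u v} → NiceWalk P A u v → NiceWalk Q B u v
  relax Q⇒P A⊆B = map λ (nice e l r i j) →
    nice e (l ∘ Q⇒P i) (r ∘ Q⇒P j) (A⊆B i) (A⊆B j)

  ∈AncSet : ∀ {A v} → v ∈ A → v ∈ AncSet g A
  ∈AncSet v∈A = _ , v∈A , ε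

  AncSet-closed : ∀ {A u v} → Directed g u v → v ∈ AncSet g A → u ∈ AncSet g A
  AncSet-closed d (t , t∈A , w) = t , t∈A , d ◅ w

  AncSet-⊆ : ∀ {A B : Pred N 0ℓ} → A ⊆ AncSet g B → AncSet g A ⊆ AncSet g B
  AncSet-⊆ A⊆B (t , t∈A , w) with A⊆B t∈A
  ... | s , s∈B , w′ = s , s∈B , w ◅◅ w′

  -- Following the arrows from a position leads to a collider or to an end.
  module _ {A : Pred N 0ℓ} (closed : ∀ {u v} → Directed g u v → v ∈ A → u ∈ A) where

    Colliders∈ : ∀ {x y} → Walk g x y → Set
    Colliders∈ π = ∀ {u v w} {e : Edge g u v} {f : Edge g v w} →
      Passes π e f → Collider g e f → v ∈ A

    tail⇒∈ : ∀ {u v y} (e : Edge g u v) (π : Walk g v y) → Colliders∈ (e ◅ π) →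
      y ∈ A → Edge.markˡ e ≡ tail → u ∈ A
    tail⇒∈ (edge {tail} {tail}      p) π col y∈ _ = ⊥-elim (noUndirected p)
    tail⇒∈ (edge {tail} {arrowhead} p) ε col y∈ _ = closed p y∈
    tail⇒∈ (edge {tail} {arrowhead} p) (f@(edge {tail} _) ◅ π) col y∈ _ =
      closed p (tail⇒∈ f π (col ∘ there) y∈ refl)
    tail⇒∈ (edge {tail} {arrowhead} p) (edge {arrowhead} _ ◅ π) col y∈ _ =
      closed p (col here (refl , refl))

    next∈ : ∀ {u v y} (e : Edge g u v) (π : Walk g v y) → Colliders∈ (e ◅ π) →
      u ∈ A → y ∈ A → v ∈ A
    next∈ e ε col u∈ y∈ = y∈
    next∈ (edge {tail}      {tail} p) (f ◅ π) col u∈ y∈ = ⊥-elim (noUndirected p)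
    next∈ (edge {arrowhead} {tail} p) (f ◅ π) col u∈ y∈ = closed (flip p) u∈
    next∈ (edge {_} {arrowhead} p) (edge {arrowhead} _ ◅ π) col u∈ y∈ = col here (refl , refl)
    next∈ (edge {_} {arrowhead} p) (f@(edge {tail} _) ◅ π) col u∈ y∈ =
      tail⇒∈ f π (col ∘ there) y∈ refl

    toNiceWalk : ∀ {P x y} (π : Walk g x y) → Colliders∈ π →
      (∀ {u v w} {e : Edge g u v} {f : Edge g v w} → Passes π e f → v ∈ P →
        StaysInScʳ e × StaysInScˡ f) →
      x ∈ A → y ∈ A → x ∉ P → y ∉ P → NiceWalk P A x y
    toNiceWalk {P} {y = y} π col stay x∈ y∈ x∉P y∉P =
        go π col stay x∈ λ x∈P → contradiction x∈P x∉P
      where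
      -- What the position before still demands of the first remaining edge.
      StartStays : ∀ {u} → Walk g u y → Set
      StartStays ε       = ⊤
      StartStays (e ◅ _) = StaysInScˡ e

      go : ∀ {u} (π : Walk g u y) → Colliders∈ π →
        (∀ {u v w} {e : Edge g u v} {f : Edge g v w} → Passes π e f → v ∈ P →
          StaysInScʳ e × StaysInScˡ f) →
        u ∈ A → (u ∈ P → StartStays π) → NiceWalk P A u y
      go ε col stay u∈ s = ε
      go (e ◅ ε) col stay u∈ s =
        nice e s (λ y∈P → contradiction y∈P y∉P) u∈ y∈ ◅ ε
      go (e ◅ π@(f ◅ _)) col stay u∈ s =
        nice e s (proj₁ ∘ stay here) u∈ v∈ ◅ go π (col ∘ there) (stay ∘ there) v∈ (proj₂ ∘ stay here)
        where v∈ = next∈ e π col u∈ y∈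

  passes-map : ∀ {P A x y u v w} (π : NiceWalk P A x y) {e : Edge g u v} {f : Edge g v w} →
    Passes (map nice-edge π) e f →
    v ∈ A × (v ∈ P → StaysInScʳ e × StaysInScˡ f)
  passes-map (e ◅ f ◅ π) here = inʳ e , λ v∈P → stayʳ e v∈P , stayˡ f v∈P
  passes-map (e ◅ π@(_ ◅ _)) (there p) = passes-map π p
  passes-map (e ◅ ε) (there ())

  collider? : ∀ {u v w} (e : Edge g u v) (f : Edge g v w) → Collider g e f ⊎ ¬ Collider g e f
  collider? (edge {_} {arrowhead} _) (edge {arrowhead} _) = inj₁ (refl , refl)
  collider? (edge {_} {tail}      _) _                    = inj₂ λ ()
  collider? (edge {_} {arrowhead} _) (edge {tail} _)      = inj₂ λ ()

  collider⇒stays : ∀ {u v w} {e : Edge g u v} {f : Edge g v w} → Collider g e f →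
    StaysInScʳ e × StaysInScˡ f
  collider⇒stays (refl , refl) = (λ _ ()) , λ ()

  unblockable⇒stays : ∀ {u v w} {e : Edge g u v} {f : Edge g v w} →
    (¬ Collider g e f → UnblockableNonCollider G e f) → StaysInScʳ e × StaysInScˡ f
  unblockable⇒stays {e = e} {f} unb with collider? e f
  ... | inj₁ c  = collider⇒stays {e = e} {f} c
  ... | inj₂ ¬c = UnblockableNonCollider.backward u , UnblockableNonCollider.forward u
    where u = unb ¬c

  σInducing⇒nice : ∀ {T : Pred N 0ℓ} {a b} → Σ (Walk g a b) (IsσInducingPath G T) →
    NiceWalk (∁ (｛ a ｝ ∪ ｛ b ｝)) (AncSet g ((｛ a ｝ ∪ ｛ b ｝) ∪ T)) a b
  σInducing⇒nice {T} {a} {b} (π , ind) =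
    toNiceWalk (AncSet-closed {(｛ a ｝ ∪ ｛ b ｝) ∪ T}) π colliders (λ p _ → unblockable⇒stays (nonColliders p))
      (∈AncSet (inj₁ (inj₁ refl))) (∈AncSet (inj₁ (inj₂ refl)))
      (λ ∉ → ∉ (inj₁ refl)) (λ ∉ → ∉ (inj₂ refl))
    where
    open IsσInducingPath ind

  module _ (em : ExcludedMiddle 0ℓ) where
    open Classical em

    σOpen⇒nice : ∀ {W x y} {π : Walk g x y} → IsσOpen G W π →
      NiceWalk W (AncSet g ((｛ x ｝ ∪ ｛ y ｝) ∪ W)) x y
    σOpen⇒nice {W} {π = π} open′ =
      toNiceWalk AncSet-closed π
        (λ p c → AncSet-⊆ (∈AncSet ∘ inj₂) (colliders p c))
        -- Openness only says that a non-collider in `W` is not blockable; excluded middle makes it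
        -- unblockable.
        (λ p v∈W → unblockable⇒stays λ ¬c →
          decidable-stable em λ ¬unb → nonColliders (inner p ¬c ¬unb) v∈W)
        (∈AncSet (inj₁ (inj₁ refl))) (∈AncSet (inj₁ (inj₂ refl)))
        (nonColliders start) (nonColliders end)
      where
      open IsσOpen open′

    -- Conditions on single edges survive the removal of loops. On the resulting path every inner
    -- position differs from both ends, so it lies in `∁ (｛ a ｝ ∪ ｛ b ｝)` and is constrained.
    nice⇒σInducing : ∀ {T a b} →
      NiceWalk (∁ (｛ a ｝ ∪ ｛ b ｝)) (AncSet g ((｛ a ｝ ∪ ｛ b ｝) ∪ T)) a b →
      Σ (Walk g a b) (IsσInducingPath G T)
    nice⇒σInducing w with toPath w
    ... | π , uniq = map nice-edge π , record
      { isPath       = uniq′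
      ; colliders    = λ p _ → proj₁ (passes-map π p)
      ; nonColliders = λ p ¬c →
          let b , f = proj₂ (passes-map π p) [ middle≢start uniq′ p , middle≢end uniq′ p ∘ sym ]′
          in record { ¬collider = ¬c ; backward = b ; forward = f }
      }
      where
      uniq′ = subst Unique (sym (nodes-map nice-edge π)) uniq

    -- If v is an ancestor of the endpoint x but not of W, a directed walk from v to
    -- x avoids W, so that it can replace the part of the walk between x and v;
    -- likewise for y.  Taking the last such v for x, and the first for y, leaves
    -- only colliders that are ancestors of W.
    module _ {W : Pred N 0ℓ} {x y : N} where
      private
        AncW : Pred N 0ℓ
        AncW = AncSet g W

      -- Openness without the endpoint conditions, as endpoints change while pieces are pasted
      -- together.
      OpenInside : ∀ {u v} → Walk g u v → Set
      OpenInside π = ∀ {u v w} {e : Edge g u v} {f : Edge g v w} → Passes π e f →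
        (Collider g e f → v ∈ AncW) × (v ∈ W → StaysInScʳ e × StaysInScˡ f)

      -- What the first node must satisfy so that it may become an inner position: with a tail on
      -- the next edge it cannot become a collider.
      Extensible : ∀ {v} → Walk g v y → Set
      Extensible ε           = ⊤
      Extensible {v} (f ◅ _) = (v ∈ AncW ⊎ Edge.markˡ f ≡ tail) × (v ∈ W → StaysInScˡ f)

      extend : ∀ {u v} (e : Edge g u v) → (v ∈ W → StaysInScʳ e) →
        (π : Walk g v y) → Extensible π → OpenInside π → OpenInside (e ◅ π)
      extend e stay ε       _              o (there ())
      extend e stay (f ◅ π) (inj₁ v∈ , s)  o here = (λ _ → v∈) , λ v∈W → stay v∈W , s v∈W
      extend e stay (f ◅ π) (inj₂ eq , s)  o here =
        (λ (_ , eq′) → case trans (sym eq) eq′ of λ ()) , λ v∈W → stay v∈W , s v∈W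
      extend e stay (f ◅ π) _              o (there p) = o p

      extendᵗ : ∀ {u v} (e : Edge g u v) → Edge.markʳ e ≡ tail → v ∉ W →
        (π : Walk g v y) → OpenInside π → OpenInside (e ◅ π)
      extendᵗ e eq v∉W π o here =
        (λ (eq′ , _) → case trans (sym eq) eq′ of λ ()) , λ v∈W → contradiction v∈W v∉W
      extendᵗ e eq v∉W π o (there p) = o p

      descend : ∀ {v} → v ∉ AncW → DirectedWalk g v y →
        Σ (Walk g v y) λ π → Extensible π × OpenInside π
      descend v∉ ε = ε , tt , λ ()
      descend v∉ (d ◅ ds) with descend (v∉ ∘ AncSet-closed d) ds
      ... | π , ext , o = edge d ◅ π ,
        (inj₂ refl , λ v∈W → contradiction (∈AncSet v∈W) v∉) ,
        extend (edge d) (λ v∈W → contradiction (AncSet-closed d (∈AncSet v∈W)) v∉) π ext o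

      climb : ∀ {v} → v ∉ AncW → DirectedWalk g v x → (π : Walk g v y) → OpenInside π →
        Σ (Walk g x y) OpenInside
      climb v∉ ε        π o = π , o
      climb v∉ (d ◅ ds) π o = climb (v∉ ∘ AncSet-closed d) ds (edge (flip d) ◅ π)
        (extendᵗ (edge (flip d)) refl (v∉ ∘ ∈AncSet) π o)

      private
        -- Either the suffix from `v` has been repaired, or a node `t` has been found from which
        -- `climb` reaches `x`, and everything before `t` will be discarded.
        Stage : N → Set
        Stage v = (Σ (Walk g v y) λ π → Extensible π × OpenInside π) ⊎
                  (∃[ t ] t ∉ AncW × DirectedWalk g t x × Σ (Walk g t y) OpenInside)

      stage : ∀ {v} → NiceWalk W (AncSet g ((｛ x ｝ ∪ ｛ y ｝) ∪ W)) v y → Stage v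
      stage ε = inj₁ (ε , tt , λ ())
      stage {v} (nice e sˡ sʳ v∈ _ ◅ w) with stage w
      ... | inj₂ found = inj₂ found
      ... | inj₁ (π , ext , o) with em {v ∈ AncW} | v∈ | extend e sʳ π ext o
      ...   | yes v∈W | _                              | o′ = inj₁ (e ◅ π , (inj₁ v∈W , sˡ) , o′)
      ...   | no  v∉W | _ , inj₁ (inj₁ refl) , ds | o′ = inj₂ (v , v∉W , ds , e ◅ π , o′)
      ...   | no  v∉W | _ , inj₁ (inj₂ refl) , ds | o′ = inj₁ (descend v∉W ds)
      ...   | no  v∉W | t , inj₂ t∈W         , ds | o′ = contradiction (t , t∈W , ds) v∉W

      openInside⇒σOpen : x ∉ W → y ∉ W → {π : Walk g x y} → OpenInside π → IsσOpen G W π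
      openInside⇒σOpen x∉W y∉W o = record
        { colliders    = λ p → proj₁ (o p)
        ; nonColliders = λ where
            start            → x∉W
            end              → y∉W
            (inner p ¬c ¬unb) v∈W → let b , f = proj₂ (o p) v∈W in
              ¬unb record { ¬collider = ¬c ; backward = b ; forward = f }
        }

      nice⇒σOpen : x ∉ W → y ∉ W → NiceWalk W (AncSet g ((｛ x ｝ ∪ ｛ y ｝) ∪ W)) x y →
        Σ (Walk g x y) (IsσOpen G W)
      nice⇒σOpen x∉W y∉W w with stage w
      ... | inj₁ (π , _ , o)          = π , openInside⇒σOpen x∉W y∉W o
      ... | inj₂ (t , t∉ , ds , π , o) =
        map₂ (openInside⇒σOpen x∉W y∉W) (climb t∉ ds π o)

-- Open walks in a mixed graph

module _ {V : Set} (H : MixedGraph V) where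
  open MixedGraph H

  AntSet : Pred V 0ℓ → Pred V 0ℓ
  AntSet T v = ∃[ t ] t ∈ T × AnteriorWalk H v t

  adj-sym : ∀ {a b} → Adjacent H a b → Adjacent H b a
  adj-sym (edge p) = edge (flip p)

  into⊎outOf : ∀ {a b} → Adjacent H a b → Into H a b ⊎ OutOf H b a
  into⊎outOf (edge {_} {tail}      p) = inj₂ (_ , flip p)
  into⊎outOf (edge {_} {arrowhead} p) = inj₁ (_ , p)

  -- The counterpart of `NiceEdge`: that a node of `Z` must be a collider is split into one
  -- condition for each of its edges.
  record OpenEdge (Z A : Pred V 0ℓ) (u v : V) : Set where
    constructor openEdge
    field
      adjacent : Adjacent H u v
      arrowˡ   : u ∈ Z → Into H v u
      arrowʳ   : v ∈ Z → Into H u v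
      inᴴˡ     : u ∈ A
      inᴴʳ     : v ∈ A

  -- A node on a walk in `G` may be an ancestor of `𝒮` alone, and then need not be anterior to `T`.
  -- An arrowhead excludes this, so only nodes with an arrowhead are constrained.
  ArrowAnt : Pred V 0ℓ → Pred V 0ℓ
  ArrowAnt T v = (∃[ a ] Into H a v) → v ∈ AntSet T

  openEdge-sym : ∀ {Z A u v} → OpenEdge Z A u v → OpenEdge Z A v u
  openEdge-sym (openEdge adj arrˡ arrʳ u∈ v∈) = openEdge (adj-sym adj) arrʳ arrˡ v∈ u∈

-- Correspondence of walks in `G` and in `H`

module Representation (em : ExcludedMiddle 0ℓ) {V S : Set}
  {G : DMG (V ⊎ S)} {H : MixedGraph V} (rep : Represents H G) where

  open Classical em
  open DMG G using (noLoop; noUndirected; flip)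
  open Represents rep using (adjacencies; arrowheads; tails)
  private
    g : MixedGraph (V ⊎ S)
    g = DMG.graph G

  Pair : V → V → Pred (V ⊎ S) 0ℓ
  Pair u v = ｛ inj₁ u ｝ ∪ ｛ inj₁ v ｝

  nice⇒adjacent : ∀ {u v} → u ≢ v →
    NiceWalk G (∁ (Pair u v)) (AncSet g (Pair u v ∪ 𝒮)) (inj₁ u) (inj₁ v) → Adjacent H u v
  nice⇒adjacent u≢v w = Equivalence.from (adjacencies u≢v) (nice⇒σInducing G em w)

  -- A directed edge of `G` is itself a σ-inducing path, and an arrowhead at `u` would contradict
  -- that `u` is an ancestor of `v`.
  directed⇒outOf : ∀ {u v} → Directed g (inj₁ u) (inj₁ v) → OutOf H u v
  directed⇒outOf {u} {v} d with into⊎outOf H (adj-sym H (nice⇒adjacent u≢v (e ◅ ε)))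
    where
    u≢v : u ≢ v
    u≢v refl = noLoop d
    e : NiceEdge G (∁ (Pair u v)) (AncSet g (Pair u v ∪ 𝒮)) (inj₁ u) (inj₁ v)
    e = nice (edge d) (λ ∉ → contradiction (inj₁ refl) ∉) (λ ∉ → contradiction (inj₂ refl) ∉)
          (∈AncSet G (inj₁ (inj₁ refl))) (∈AncSet G (inj₁ (inj₂ refl)))
  ... | inj₁ into  = contradiction (_ , inj₁ refl , d ◅ ε) (arrowheads into)
  ... | inj₂ outOf = outOf

  module _ (Z : Pred V 0ℓ) (x y : V) where

    W : Pred (V ⊎ S) 0ℓ
    W = embed Z ∪ 𝒮

    T : Pred V 0ℓ
    T = Z ∪ (｛ x ｝ ∪ ｛ y ｝)

    AncW : Pred (V ⊎ S) 0ℓ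
    AncW = AncSet g (Pair x y ∪ W)

    Connected : Set
    Connected = NiceWalk G W AncW (inj₁ x) (inj₁ y)

    -- Each step starts at an ancestor of the next node or of `𝒮`; in the second case `𝒮 ⊆ W` ends
    -- the argument.
    anterior⇒AncW : ∀ {u t} → t ∈ T → AnteriorWalk H u t → inj₁ u ∈ AncW
    anterior⇒AncW (inj₁ t∈Z)         ε = ∈AncSet G (inj₂ (inj₁ t∈Z))
    anterior⇒AncW (inj₂ (inj₁ refl)) ε = ∈AncSet G (inj₁ (inj₁ refl))
    anterior⇒AncW (inj₂ (inj₂ refl)) ε = ∈AncSet G (inj₁ (inj₂ refl))
    anterior⇒AncW t∈T (o ◅ os) with tails o
    ... | s , inj₂ s∈S  , ds = s , inj₂ (inj₂ s∈S) , ds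
    ... | _ , inj₁ refl , ds with anterior⇒AncW t∈T os
    ...   | s , s∈ , ds′ = s , s∈ , ds ◅◅ ds′

    AntSet⇒AncW : ∀ {u} → u ∈ AntSet H T → inj₁ u ∈ AncW
    AntSet⇒AncW (_ , t∈T , os) = anterior⇒AncW t∈T os

    -- Outside the ancestors of `𝒮` the directed walk cannot enter `𝒮`, so each of its edges has a
    -- counterpart in `H`.
    AncW⇒AntSet : ∀ {u t} → DirectedWalk g (inj₁ u) t → t ∈ Pair x y ∪ W →
      inj₁ u ∉ AncSet g 𝒮 → u ∈ AntSet H T
    AncW⇒AntSet ε (inj₁ (inj₁ refl)) u∉ = _ , inj₂ (inj₁ refl) , ε
    AncW⇒AntSet ε (inj₁ (inj₂ refl)) u∉ = _ , inj₂ (inj₂ refl) , ε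
    AncW⇒AntSet ε (inj₂ (inj₁ u∈Z))  u∉ = _ , inj₁ u∈Z , ε
    AncW⇒AntSet (_◅_ {j = inj₂ s} d ds) t∈ u∉ = contradiction (inj₂ s , tt , d ◅ ε) u∉
    AncW⇒AntSet (_◅_ {j = inj₁ v} d ds) t∈ u∉
      with AncW⇒AntSet ds t∈ (u∉ ∘ AncSet-closed G d)
    ... | t , t∈T , os = t , t∈T , directed⇒outOf d ◅ os

    -- An arrowhead at u on the edge u - v of H forces every node that lies after u
    -- on an inducing path representing that edge into Sc(u).
    openEdge⇒nice : ∀ {u v} → OpenEdge H Z (AntSet H T) u v →
      NiceWalk G W AncW (inj₁ u) (inj₁ v)
    openEdge⇒nice {u} {v} (openEdge adj arrˡ arrʳ u∈ v∈) =
      map refine (σInducing⇒nice G (Equivalence.to (adjacencies u≢v) adj))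
      where
      u≢v : u ≢ v
      u≢v refl = IsSimple.noLoop (Represents.simple rep) adj

      A : Pred (V ⊎ S) 0ℓ
      A = AncSet g (Pair u v ∪ 𝒮)

      A⊆AncW : A ⊆ AncW
      A⊆AncW = AncSet-⊆ G λ where
        (inj₁ (inj₁ refl)) → AntSet⇒AncW u∈
        (inj₁ (inj₂ refl)) → AntSet⇒AncW v∈
        (inj₂ s∈)          → ∈AncSet G (inj₂ (inj₂ s∈))

      -- A node of `A` is an ancestor of `u`, `v` or `𝒮`; the arrowhead at `u` leaves only `u`.
      returnˡ : ∀ {n} → u ∈ Z → Directed g (inj₁ u) n → n ∈ A → n ∈ Sc G (inj₁ u)
      returnˡ u∈Z d (_ , inj₁ (inj₁ refl) , ds) = ds , d ◅ ε
      returnˡ u∈Z d (_ , inj₁ (inj₂ refl) , ds) =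
        contradiction (_ , inj₁ refl , d ◅ ds) (arrowheads (arrˡ u∈Z))
      returnˡ u∈Z d (_ , inj₂ s∈ , ds) =
        contradiction (_ , inj₂ s∈ , d ◅ ds) (arrowheads (arrˡ u∈Z))

      returnʳ : ∀ {n} → v ∈ Z → Directed g (inj₁ v) n → n ∈ A → n ∈ Sc G (inj₁ v)
      returnʳ v∈Z d (_ , inj₁ (inj₂ refl) , ds) = ds , d ◅ ε
      returnʳ v∈Z d (_ , inj₁ (inj₁ refl) , ds) =
        contradiction (_ , inj₁ refl , d ◅ ds) (arrowheads (arrʳ v∈Z))
      returnʳ v∈Z d (_ , inj₂ s∈ , ds) =
        contradiction (_ , inj₂ s∈ , d ◅ ds) (arrowheads (arrʳ v∈Z))

      return : ∀ {m n} → m ∈ W → m ∈ Pair u v → Directed g m n → n ∈ A → n ∈ Sc G m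
      return (inj₁ u∈Z) (inj₁ refl) = returnˡ u∈Z
      return (inj₁ v∈Z) (inj₂ refl) = returnʳ v∈Z

      refine : ∀ {m n} → NiceEdge G (∁ (Pair u v)) A m n → NiceEdge G W AncW m n
      refine {m} {n} (nice e sˡ sʳ i j) = nice e stayˡ′ stayʳ′ (A⊆AncW i) (A⊆AncW j)
        where
        stayˡ′ : m ∈ W → StaysInScˡ G e
        stayˡ′ m∈W with em {m ∈ Pair u v}
        ... | no  m∉ = sˡ m∉
        ... | yes m∈ = λ { refl refl → return m∈W m∈ (Edge.present e) j }
        stayʳ′ : n ∈ W → StaysInScʳ G e
        stayʳ′ n∈W with em {n ∈ Pair u v}
        ... | no  n∉ = sʳ n∉
        ... | yes n∈ = λ { refl refl → return n∈W n∈ (flip (Edge.present e)) i }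

    openWalk⇒connected : Star (OpenEdge H Z (AntSet H T)) x y → Connected
    openWalk⇒connected = kleisliStar inj₁ openEdge⇒nice

    -- Unlike on an inducing path, an endpoint in Z is constrained too; hence it can be
    -- dropped from a chain of links if it is an ancestor of one of its neighbours.
    LinkP LinkA : V → V → Pred (V ⊎ S) 0ℓ
    LinkP u v = W ∪ ∁ (Pair u v)
    LinkA u v = AncSet g (Pair u v ∪ 𝒮)

    record Link (u v : V) : Set where
      constructor link
      field
        walk  : NiceWalk G (LinkP u v) (LinkA u v) (inj₁ u) (inj₁ v)
        linkˡ : inj₁ u ∈ AncW
        linkʳ : inj₁ v ∈ AncW

    link⇒adjacent : ∀ {u v} → u ≢ v → Link u v → Adjacent H u v
    link⇒adjacent u≢v (link w _ _) = nice⇒adjacent u≢v (relax G (λ _ → inj₂) id w)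

    -- Ancestors of `v` are then ancestors of `u`, `w` or `𝒮`. At `v` itself both walks already stay
    -- in the component, because `v ∈ Z`.
    splice : ∀ {u v w} → v ∈ Z → inj₁ v ∈ LinkA u w → Link u v → Link v w → Link u w
    splice {u} {v} {w} v∈Z v∈ (link p u∈ _) (link q _ w∈) =
      link (relax G l (AncSet-⊆ G ⊆ˡ) p ◅◅ relax G r (AncSet-⊆ G ⊆ʳ) q) u∈ w∈
      where
      l : ∀ {n} → n ∈ LinkA u v → n ∈ LinkP u w → n ∈ LinkP u v
      l _ (inj₁ n∈) = inj₁ n∈
      l {n} _ (inj₂ n∉) with em {inj₁ v ≡ n}
      ... | yes refl = inj₁ (inj₁ v∈Z)
      ... | no  v≢n  = inj₂ [ n∉ ∘ inj₁ , v≢n ]′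
      r : ∀ {n} → n ∈ LinkA v w → n ∈ LinkP u w → n ∈ LinkP v w
      r _ (inj₁ n∈) = inj₁ n∈
      r {n} _ (inj₂ n∉) with em {inj₁ v ≡ n}
      ... | yes refl = inj₁ (inj₁ v∈Z)
      ... | no  v≢n  = inj₂ [ v≢n , n∉ ∘ inj₂ ]′
      ⊆ˡ : Pair u v ∪ 𝒮 ⊆ LinkA u w
      ⊆ˡ (inj₁ (inj₁ eq))   = ∈AncSet G (inj₁ (inj₁ eq))
      ⊆ˡ (inj₁ (inj₂ refl)) = v∈
      ⊆ˡ (inj₂ s∈)          = ∈AncSet G (inj₂ s∈)
      ⊆ʳ : Pair v w ∪ 𝒮 ⊆ LinkA u w
      ⊆ʳ (inj₁ (inj₁ refl)) = v∈
      ⊆ʳ (inj₁ (inj₂ eq))   = ∈AncSet G (inj₁ (inj₂ eq))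
      ⊆ʳ (inj₂ s∈)          = ∈AncSet G (inj₂ s∈)

    private
      -- The walk is cut at its nodes in `V`. A piece that starts in `𝒮` waits for its left end, so
      -- it is kept apart from the finished links.
      Cut : V ⊎ S → Set
      Cut (inj₁ u) = Star Link u y
      Cut (inj₂ s) = ∃[ v ] NiceWalk G W (𝒮 ∪ ｛ inj₁ v ｝) (inj₂ s) (inj₁ v) ×
                     inj₁ v ∈ AncW × Star Link v y

    cut : ∀ {n} → NiceWalk G W AncW n (inj₁ y) → Cut n
    cut ε = ε
    cut {inj₁ u} (_◅_ {j = inj₁ v} (nice e sˡ sʳ i j) w) = link (nice e
        (λ { (inj₁ u∈) → sˡ u∈ ; (inj₂ ∉) → contradiction (inj₁ refl) ∉ })
        (λ { (inj₁ v∈) → sʳ v∈ ; (inj₂ ∉) → contradiction (inj₂ refl) ∉ })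
        (∈AncSet G (inj₁ (inj₁ refl))) (∈AncSet G (inj₁ (inj₂ refl))) ◅ ε) i j ◅ cut w
    cut {inj₁ u} (_◅_ {j = inj₂ s} (nice e sˡ sʳ i j) w) with cut w
    ... | v , p , v∈ , ls = link (nice e
        (λ { (inj₁ u∈) → sˡ u∈ ; (inj₂ ∉) → contradiction (inj₁ refl) ∉ })
        (λ _ → sʳ (inj₂ tt))
        (∈AncSet G (inj₁ (inj₁ refl))) (∈AncSet G (inj₂ tt)) ◅ relax G
          (λ { (inj₁ s∈) _ → inj₂ s∈
             ; (inj₂ refl) (inj₁ v∈W) → v∈W
             ; (inj₂ refl) (inj₂ ∉) → contradiction (inj₂ refl) ∉ })
          (λ { (inj₁ s∈) → ∈AncSet G (inj₂ s∈)
             ; (inj₂ refl) → ∈AncSet G (inj₁ (inj₂ refl)) }) p) i v∈ ◅ ls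
    cut {inj₂ s} (_◅_ {j = inj₁ v} (nice e sˡ sʳ i j) w) =
      v , nice e sˡ sʳ (inj₁ tt) (inj₂ refl) ◅ ε , j , cut w
    cut {inj₂ s} (_◅_ {j = inj₂ s′} (nice e sˡ sʳ i j) w) with cut w
    ... | v , p , v∈ , ls = v , nice e sˡ sʳ (inj₁ tt) (inj₁ tt) ◅ p , v∈ , ls

    AncW⇒ArrowAnt : ∀ {v} → inj₁ v ∈ AncW → v ∈ ArrowAnt H T
    AncW⇒ArrowAnt (t , t∈ , ds) (_ , into) =
      AncW⇒AntSet ds t∈ λ (s , s∈ , ds′) → arrowheads into (s , inj₂ s∈ , ds′)

    module _ (x∉Z : x ∉ Z) (y∉Z : y ∉ Z) where

      -- A tail at `v` makes `v` an ancestor of `u` or of `𝒮`, so `splice` merges the two links at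
      -- `v` into one.
      dropʳ : ∀ {u v} → v ∈ Z → OutOf H v u → Link u v → (w : Star Link v y) →
        Σ (Star Link u y) λ w′ → length w′ ≡ length w
      dropʳ v∈Z out l ε        = contradiction v∈Z y∉Z
      dropʳ v∈Z out l (l′ ◅ w) = splice v∈Z (AncSet-⊆ G (λ where
        (inj₁ eq) → ∈AncSet G (inj₁ (inj₁ eq))
        (inj₂ s∈) → ∈AncSet G (inj₂ s∈)) (tails out)) l l′ ◅ w , refl

      dropˡ : ∀ {u v} → u ∈ Z → OutOf H u v → (w : Star Link x u) → Link u v →
        Σ (Star Link x v) λ w′ → length w′ ≡ length w
      dropˡ u∈Z out ε        l = contradiction u∈Z x∉Z
      dropˡ u∈Z out (k ◅ ks) l with unsnoc k ks
      ... | d , p , k′ , eq = p ◅◅ l′ ◅ ε ,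
        trans (length-◅◅ p (l′ ◅ ε)) (trans (+-comm (length p) 1) (cong suc eq))
        where
        l′ = splice u∈Z (AncSet-⊆ G (λ where
          (inj₁ eq) → ∈AncSet G (inj₁ (inj₂ eq))
          (inj₂ s∈) → ∈AncSet G (inj₂ s∈)) (tails out)) k′ l

      shortest⇒open : ∀ {u} (pre : Star Link x u) (w : Star Link u y) →
        ((w′ : Star Link x y) → length pre + length w ≤ length w′) →
        Star (OpenEdge H Z (ArrowAnt H T)) u y
      shortest⇒open pre ε shortest = ε
      shortest⇒open {u} pre (_◅_ {j = v} l w) shortest =
        openEdge (link⇒adjacent u≢v l) arrˡ arrʳ (AncW⇒ArrowAnt (Link.linkˡ l)) (AncW⇒ArrowAnt (Link.linkʳ l))
        ◅ shortest⇒open (pre ◅◅ l ◅ ε) w λ w′ → ≤-trans (≤-reflexive len) (shortest w′)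
        where
        len : length (pre ◅◅ l ◅ ε) + length w ≡ length pre + suc (length w)
        len = trans (cong (_+ length w) (length-◅◅ pre (l ◅ ε))) (+-assoc (length pre) 1 (length w))

        impossible : ∀ {u′} (p : Star Link x u′) (q : Star Link u′ y) →
          length p + length q < length pre + suc (length w) → ⊥
        impossible p q lt = <⇒≱ lt (≤-trans (shortest (p ◅◅ q)) (≤-reflexive (length-◅◅ p q)))

        u≢v : u ≢ v
        u≢v refl = impossible pre w (+-monoʳ-< (length pre) (n<1+n (length w)))

        arrʳ : v ∈ Z → Into H u v
        arrʳ v∈Z with into⊎outOf H (link⇒adjacent u≢v l)
        ... | inj₁ into = into
        ... | inj₂ out  with dropʳ v∈Z out l w
        ...   | w′ , eq = ⊥-elim (impossible pre w′
          (+-monoʳ-< (length pre) (≤-reflexive (cong suc eq))))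

        arrˡ : u ∈ Z → Into H v u
        arrˡ u∈Z with into⊎outOf H (adj-sym H (link⇒adjacent u≢v l))
        ... | inj₁ into = into
        ... | inj₂ out  with dropˡ u∈Z out pre l
        ...   | p , eq = ⊥-elim (impossible p w
          (subst (λ n → n + length w < length pre + suc (length w)) (sym eq)
            (+-monoʳ-< (length pre) (n<1+n (length w)))))

      connected⇒openWalk : Connected → Star (OpenEdge H Z (ArrowAnt H T)) x y
      connected⇒openWalk c with least {λ n → Σ (Star Link x y) λ w → length w ≡ n} (_ , cut c , refl)
      ... | n , (w , refl) , min = shortest⇒open ε w λ w′ → min (w′ , refl)

module _ {V : Set} {H : MixedGraph V} where

  collider⇒into : ∀ {u v w} (e : Edge H u v) (f : Edge H v w) → Collider H e f →
    Into H u v × Into H w v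
  collider⇒into (edge p) (edge q) (refl , refl) = (_ , p) , (_ , MixedGraph.flip H q)

  collider⊎outOf : ∀ {u v w} (e : Edge H u v) (f : Edge H v w) →
    Collider H e f ⊎ (OutOf H v u ⊎ OutOf H v w)
  collider⊎outOf (edge {_} {arrowhead} p) (edge {arrowhead} q) = inj₁ (refl , refl)
  collider⊎outOf (edge {_} {tail}      p) _                    = inj₂ (inj₁ (_ , MixedGraph.flip H p))
  collider⊎outOf (edge {_} {arrowhead} p) (edge {tail} q)      = inj₂ (inj₂ (_ , q))

  walk⇒openWalk : ∀ {Z A a c} (π : Walk H a c) →
    (∀ {u v w} {e : Edge H u v} {f : Edge H v w} → Passes π e f →
      (Into H u v × Into H w v) × v ∈ A) →
    a ∉ Z → c ∉ Z → a ∈ A → c ∈ A → Star (OpenEdge H Z A) a c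
  walk⇒openWalk {Z} {A} {a} {c} π into a∉Z c∉Z a∈A c∈A =
      go π into a∈A λ a∈Z → contradiction a∈Z a∉Z
    where
    StartInto : ∀ {u} → Walk H u c → Set
    StartInto ε                   = ⊤
    StartInto {u} (_◅_ {j = v} _ _) = Into H v u

    go : ∀ {u} (π : Walk H u c) →
      (∀ {u v w} {e : Edge H u v} {f : Edge H v w} → Passes π e f →
        (Into H u v × Into H w v) × v ∈ A) →
      u ∈ A → (u ∈ Z → StartInto π) → Star (OpenEdge H Z A) u c
    go ε             into u∈A s = ε
    go (e ◅ ε)       into u∈A s = openEdge e s (λ c∈Z → contradiction c∈Z c∉Z) u∈A c∈A ◅ ε
    go (e ◅ π@(_ ◅ _)) into u∈A s =
      openEdge e s (λ _ → proj₁ (proj₁ (into here))) u∈A (proj₂ (into here))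
      ◅ go π (into ∘ there) (proj₂ (into here)) λ _ → proj₂ (proj₁ (into here))

∷-∷ʳ : ∀ {A : Set} (x : A) xs → ∃[ ys ] ∃[ y ] x ∷ xs ≡ ys ++ y ∷ []
∷-∷ʳ x []       = [] , x , refl
∷-∷ʳ x (y ∷ ys) with ∷-∷ʳ y ys
... | zs , z , eq = x ∷ zs , z , cong (x ∷_) eq

-- Markov equivalence implies the three conditions

module Forward (em : ExcludedMiddle 0ℓ) {V S : Set} {G₁ G₂ : DMG (V ⊎ S)} {H₁ H₂ : MixedGraph V}
  (rep₁ : Represents H₁ G₁) (rep₂ : Represents H₂ G₂) (equiv : σMarkovEquivalent G₁ G₂) where

  private
    module R₁ = Representation em rep₁
    module R₂ = Representation em rep₂
    g₂ = DMG.graph G₂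

  module _ {a c : V} (a≢c : a ≢ c) (¬adj : ¬ Adjacent H₂ a c) where

    Separator : Pred V 0ℓ
    Separator v = inj₁ v ∈ AncSet g₂ (R₂.Pair a c ∪ 𝒮) × v ∉ ｛ a ｝ ∪ ｛ c ｝

    T : Pred V 0ℓ
    T = R₁.T Separator a c

    -- Given `Separator`, an open walk between `a` and `c` in `G₂` visits only ancestors of `a`, `c`
    -- and `𝒮`, so all its nodes but `a` and `c` are conditioned on. It would yield a σ-inducing
    -- path, making `a` and `c` adjacent in `H₂`. Hence they are separated in `G₂` and by
    -- equivalence in `G₁`, where the walk would connect them.
    separates : ¬ Star (OpenEdge H₁ Separator (AntSet H₁ T)) a c
    separates w with nice⇒σOpen G₁ em a∉ c∉ (R₁.openWalk⇒connected Separator a c w)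
      where
      a∉ : inj₁ a ∉ R₁.W Separator a c
      a∉ (inj₁ (_ , ∉)) = ∉ (inj₁ refl)
      c∉ : inj₁ c ∉ R₁.W Separator a c
      c∉ (inj₁ (_ , ∉)) = ∉ (inj₂ refl)
    ... | π , open₁ = Equivalence.from (equiv ｛ a ｝ ｛ c ｝ Separator) sep₂ refl refl π open₁
      where
      ⊆A : R₂.Pair a c ∪ R₂.W Separator a c ⊆ AncSet g₂ (R₂.Pair a c ∪ 𝒮)
      ⊆A (inj₁ n∈) = ∈AncSet G₂ (inj₁ n∈)
      ⊆A {inj₁ v} (inj₂ (inj₁ v∈)) = proj₁ v∈
      ⊆A {inj₂ s} (inj₂ _) = ∈AncSet G₂ (inj₂ tt)

      inner∈W : ∀ {n} → n ∈ R₂.AncW Separator a c → n ∈ ∁ (R₂.Pair a c) → n ∈ R₂.W Separator a c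
      inner∈W {inj₂ s} _ _ = inj₂ tt
      inner∈W {inj₁ v} v∈ v∉ = inj₁ (AncSet-⊆ G₂ ⊆A v∈ , λ where
        (inj₁ refl) → v∉ (inj₁ refl)
        (inj₂ refl) → v∉ (inj₂ refl))

      sep₂ : σSeparated G₂ (embed ｛ a ｝) (embed ｛ c ｝) (embed Separator ∪ 𝒮)
      sep₂ {inj₁ _} {inj₁ _} refl refl π open₂ = ¬adj (R₂.nice⇒adjacent a≢c
        (relax G₂ inner∈W (AncSet-⊆ G₂ ⊆A) (σOpen⇒nice G₂ em open₂)))

    a∉Separator : a ∉ Separator
    a∉Separator (_ , ∉) = ∉ (inj₁ refl)

    c∉Separator : c ∉ Separator
    c∉Separator (_ , ∉) = ∉ (inj₂ refl)

    -- A collider path inside the separator would be open.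
    no-colliderWalk : (π : Walk H₁ a c) →
      ¬ (∀ {u v w} {e : Edge H₁ u v} {f : Edge H₁ v w} → Passes π e f →
         (Into H₁ u v × Into H₁ w v) × v ∈ Separator)
    no-colliderWalk π into = separates (walk⇒openWalk π
      (λ p → let arr , v∈ = into p in arr , (_ , inj₁ v∈ , ε)) a∉Separator c∉Separator
      (_ , inj₂ (inj₁ refl) , ε) (_ , inj₂ (inj₂ refl) , ε))

  -- A single edge is a collider walk without inner positions.
  adjacent₁⇒₂ : ∀ {a b} → Adjacent H₁ a b → Adjacent H₂ a b
  adjacent₁⇒₂ {a} {b} adj = decidable-stable em λ ¬adj →
    no-colliderWalk (λ { refl → IsSimple.noLoop (Represents.simple rep₁) adj }) ¬adj
      (adj ◅ ε) λ { (there ()) }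

  tails-AncSet : ∀ {B : Pred (V ⊎ S) 0ℓ} {u v} → OutOf H₂ u v →
    inj₁ v ∈ AncSet g₂ (B ∪ 𝒮) → inj₁ u ∈ AncSet g₂ (B ∪ 𝒮)
  tails-AncSet out v∈ = AncSet-⊆ G₂ (λ { (inj₁ refl) → v∈ ; (inj₂ s∈) → ∈AncSet G₂ (inj₂ s∈) })
    (Represents.tails rep₂ out)

  module _ (adjacent₂⇒₁ : ∀ {a b} → Adjacent H₂ a b → Adjacent H₁ a b) where

    -- A tail at `b` in `H₂` puts `b` into the separator of `a` and `c`, and then the collider walk
    -- `a`, `b`, `c` of `H₁` lies inside it.
    unshieldedCollider₁⇒₂ : ∀ {a b c} → UnshieldedCollider H₁ a b c → UnshieldedCollider H₂ a b c
    unshieldedCollider₁⇒₂ {a} {b} {c} (triple , into-a , into-c) =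
        record { UnshieldedTriple triple using (a≢b; b≢c; a≢c)
               ; adjˡ = adjacent₁⇒₂ adjˡ ; adjʳ = adjacent₁⇒₂ adjʳ ; ¬adj = ¬adj ∘ adjacent₂⇒₁ } ,
        arrow (adjacent₁⇒₂ adjˡ) (inj₁ refl) , arrow (adj-sym H₂ (adjacent₁⇒₂ adjʳ)) (inj₂ refl)
      where
      open UnshieldedTriple triple
      arrow : ∀ {d} → Adjacent H₂ d b → d ∈ ｛ a ｝ ∪ ｛ c ｝ → Into H₂ d b
      arrow {d} adj d∈ with into⊎outOf H₂ adj
      ... | inj₁ into = into
      ... | inj₂ out  = ⊥-elim (no-colliderWalk a≢c (¬adj ∘ adjacent₂⇒₁) (adjˡ ◅ adjʳ ◅ ε) λ where
          here               → (into-a , into-c) , b∈ , λ { (inj₁ refl) → a≢b refl ; (inj₂ refl) → b≢c refl }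
          (there (there ())))
        where
        b∈ : inj₁ b ∈ AncSet g₂ (R₂.Pair a c ∪ 𝒮)
        b∈ = tails-AncSet out (∈AncSet G₂ (inj₁ (Sum.map (cong inj₁) (cong inj₁) d∈)))

    -- The nodes of `vs` are parents of `c` in `H₂`, so they lie in the separator. If `b` were not a
    -- collider in `H₂`, it would have a tail towards `c` or the last node `l` of `vs` and lie there
    -- too, although all inner nodes are colliders in `H₁`.
    discriminatedCollider₁⇒₂ : ∀ {a c} b (π : Walk H₁ a c) (π′ : Walk H₂ a c) →
      nodes π ≡ nodes π′ → IsDiscriminatingPath H₁ b π → IsDiscriminatingPath H₂ b π′ →
      IsColliderOn H₁ b π → IsColliderOn H₂ b π′
    discriminatedCollider₁⇒₂ {a} {c} b π π′ eq d₁ d₂ (_ , _ , e₁ , f₁ , p₁ , col₁)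
      with ∷-∷ʳ (List⁺.head (IsDiscriminatingPath.vs d₂)) (List⁺.tail (IsDiscriminatingPath.vs d₂))
    ... | ys , l , vs-eq
      with nodes⇒passes π′ (a ∷ ys)
             (trans (IsDiscriminatingPath.shape d₂)
               (cong (a ∷_) (trans (cong (_++ b ∷ c ∷ []) vs-eq) (++-assoc ys (l ∷ []) (b ∷ c ∷ [])))))
    ... | e₂ , f₂ , p₂ with collider⊎outOf e₂ f₂
    ...   | inj₁ col₂ = _ , _ , e₂ , f₂ , p₂ , col₂
    ...   | inj₂ out  = ⊥-elim (no-colliderWalk a≢c D₂.¬adj π λ p →
              into p , inSeparator p , [ middle≢start D₁.isPath p , middle≢end D₁.isPath p ∘ sym ]′)
      where
      module D₁ = IsDiscriminatingPath d₁
      module D₂ = IsDiscriminatingPath d₂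

      a≢c : a ≢ c
      a≢c with D₁.shape | D₁.isPath
      ... | shape | uniq with subst Unique shape uniq
      ... | a∉ ∷ _ = lookup a∉ (∈-++⁺ʳ (toList D₁.vs) (there (here refl)))

      vs-same : toList D₁.vs ≡ toList D₂.vs
      vs-same = ++-cancelʳ _ _ _ (∷-injectiveʳ (trans (sym D₁.shape) (trans eq D₂.shape)))

      position : ∀ {u v w} {e : Edge H₁ u v} {f : Edge H₁ v w} → Passes π e f →
        v ∈ˡ toList D₁.vs ⊎ b ≡ v
      position p with subst (_ ∈ˡ_) D₁.shape (middle∈nodes p)
      ... | here refl = contradiction refl (middle≢start D₁.isPath p)
      ... | there v∈ with ∈-++⁻ (toList D₁.vs) v∈
      ...   | inj₁ v∈vs                  = inj₁ v∈vs
      ...   | inj₂ (here refl)           = inj₂ refl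
      ...   | inj₂ (there (here refl))   = contradiction refl (middle≢end D₁.isPath p)

      into : ∀ {u v w} {e : Edge H₁ u v} {f : Edge H₁ v w} → Passes π e f →
        Into H₁ u v × Into H₁ w v
      into p with position p
      ... | inj₂ refl with neighbours-unique D₁.isPath p p₁
      ...   | refl , refl = collider⇒into e₁ f₁ col₁
      into p | inj₁ v∈vs with D₁.colliders _ v∈vs
      ...   | (_ , _ , e , f , q , col) , _ with neighbours-unique D₁.isPath p q
      ...     | refl , refl = collider⇒into e f col

      c∈ : inj₁ c ∈ AncSet g₂ (R₂.Pair a c ∪ 𝒮)
      c∈ = ∈AncSet G₂ (inj₁ (inj₂ refl))

      vs⊆ : ∀ {v} → v ∈ˡ toList D₂.vs → inj₁ v ∈ AncSet g₂ (R₂.Pair a c ∪ 𝒮)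
      vs⊆ v∈ = tails-AncSet (_ , proj₂ (D₂.colliders _ v∈)) c∈

      inSeparator : ∀ {u v w} {e : Edge H₁ u v} {f : Edge H₁ v w} → Passes π e f →
        inj₁ v ∈ AncSet g₂ (R₂.Pair a c ∪ 𝒮)
      inSeparator {v = v} p with position p
      ... | inj₁ v∈vs = vs⊆ (subst (v ∈ˡ_) vs-same v∈vs)
      ... | inj₂ refl =
        [ (λ b-*l → tails-AncSet b-*l (vs⊆ (subst (l ∈ˡ_) (sym vs-eq) (∈-++⁺ʳ ys (here refl)))))
        , (λ b-*c → tails-AncSet b-*c c∈) ]′ out

-- Forced marks in a σ-MAG

module MAG (em : ExcludedMiddle 0ℓ) {V : Set} {H : MixedGraph V} (mag : IsσMAG H) where
  open Classical em
  open MixedGraph H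
  open IsσMAG mag

  anterior⇒¬into : ∀ {a b} → AnteriorWalk H a b → ¬ Into H b a
  anterior⇒¬into = ancestral ∘ toPath

  adjacent⇒≢ : ∀ {a b} → Adjacent H a b → a ≢ b
  adjacent⇒≢ adj refl = IsSimple.noLoop simple adj

  into⇒arrowhead : ∀ {a b} (e : Edge H a b) → Into H a b → Edge.markʳ e ≡ arrowhead
  into⇒arrowhead e (_ , p) = proj₂ (IsSimple.unique simple (adjacent⇒≢ e) (Edge.present e) p)

  directed⊎undirected : ∀ {a b} → OutOf H a b → Directed H a b ⊎ Undirected H a b
  directed⊎undirected (tail      , p) = inj₂ p
  directed⊎undirected (arrowhead , p) = inj₁ p

  into+outOf⇒directed : ∀ {a b} → Into H a b → OutOf H a b → Directed H a b
  into+outOf⇒directed into out with directed⊎undirected out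
  ... | inj₁ d = d
  ... | inj₂ u = contradiction into (anterior⇒¬into ((tail , flip u) ◅ ε))

  outOf⇒adjacent : ∀ {a b} → OutOf H a b → Adjacent H a b
  outOf⇒adjacent (_ , p) = edge p

  -- Here and in the next two lemmas the other mark would close an anterior walk against an
  -- arrowhead.
  into-child : ∀ {p a c} → Into H p a → Directed H a c → Adjacent H p c → Into H p c
  into-child into d adj with into⊎outOf H adj
  ... | inj₁ into′ = into′
  ... | inj₂ out   = contradiction into (anterior⇒¬into ((_ , d) ◅ out ◅ ε))

  into-undirected : ∀ {a b c} → Into H a b → Undirected H b c → Into H a c
  into-undirected into u with into⊎outOf H (complete₁ into u)
  ... | inj₁ into′ = into′
  ... | inj₂ out   = contradiction into (anterior⇒¬into ((_ , u) ◅ out ◅ ε))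

  undirected-into : ∀ {a b c} → Into H a b → Undirected H b c → Into H b a → Into H c a
  undirected-into into u into′ with into⊎outOf H (adj-sym H (complete₁ into u))
  ... | inj₁ into″ = into″
  ... | inj₂ out   = contradiction into′ (anterior⇒¬into (out ◅ (_ , flip u) ◅ ε))

-- Walks from sequences of nodes

-- The walk v n, …, v 1, v 0, c: the indices increase away from c.
module Outward {V : Set} (v : ℕ → V) (c : V) where

  outward : ℕ → List V
  outward zero    = v 0 ∷ c ∷ []
  outward (suc n) = v (suc n) ∷ outward n

  outward-head : ∀ n → ∃[ ys ] outward n ≡ v n ∷ ys
  outward-head zero    = _ , refl
  outward-head (suc n) = _ , refl

  outward-suffix : ∀ {k n} → k ≤ n → ∃[ xs ] outward n ≡ xs ++ outward k
  outward-suffix k≤n = go (≤⇒≤′ k≤n)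
    where
    go : ∀ {k n} → k ≤′ n → ∃[ xs ] outward n ≡ xs ++ outward k
    go ≤′-refl        = [] , refl
    go (≤′-step k≤′n) with go k≤′n
    ... | xs , eq = _ , cong (_ ∷_) eq

  ∈outward : ∀ {w} n → w ∈ˡ outward n → (∃[ k ] k ≤ n × w ≡ v k) ⊎ w ≡ c
  ∈outward zero    (here refl)         = inj₁ (0 , z≤n , refl)
  ∈outward zero    (there (here refl)) = inj₂ refl
  ∈outward (suc n) (here refl)         = inj₁ (suc n , ≤-refl , refl)
  ∈outward (suc n) (there w∈) with ∈outward n w∈
  ... | inj₁ (k , k≤n , eq) = inj₁ (k , m≤n⇒m≤1+n k≤n , eq)
  ... | inj₂ eq             = inj₂ eq

  outward-unique : ∀ n → (∀ {j k} → j < k → k ≤ n → v j ≢ v k) →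
    (∀ {k} → k ≤ n → v k ≢ c) → Unique (outward n)
  outward-unique zero    distinct ≢c = (≢c z≤n ∷ []) ∷ [] ∷ []
  outward-unique (suc n) distinct ≢c =
    All.tabulate fresh ∷ outward-unique n (λ j<k → distinct j<k ∘ m≤n⇒m≤1+n) (≢c ∘ m≤n⇒m≤1+n)
    where
    fresh : ∀ {w} → w ∈ˡ outward n → v (suc n) ≢ w
    fresh w∈ eq with ∈outward n w∈
    ... | inj₁ (k , k≤n , refl) = distinct (s≤s k≤n) ≤-refl (sym eq)
    ... | inj₂ refl             = ≢c ≤-refl eq

  inward : ℕ → List V
  inward zero    = []
  inward (suc n) = v (suc n) ∷ inward n

  outward≡inward++ : ∀ n → outward n ≡ inward n ++ v 0 ∷ c ∷ []
  outward≡inward++ zero    = refl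
  outward≡inward++ (suc n) = cong (_ ∷_) (outward≡inward++ n)

  ∈inward : ∀ {w} n → w ∈ˡ inward n → ∃[ k ] k < n × w ≡ v (suc k)
  ∈inward (suc n) (here refl) = n , ≤-refl , refl
  ∈inward (suc n) (there w∈) with ∈inward n w∈
  ... | k , k<n , eq = k , m≤n⇒m≤1+n k<n , eq

  module _ {H : MixedGraph V} where

    outwardWalk : ∀ n → (∀ {k} → k < n → Adjacent H (v (suc k)) (v k)) →
      Adjacent H (v 0) c → Walk H (v n) c
    outwardWalk zero    adj last = last ◅ ε
    outwardWalk (suc n) adj last = adj ≤-refl ◅ outwardWalk n (adj ∘ m≤n⇒m≤1+n) last

    nodes-outwardWalk : ∀ n (adj : ∀ {k} → k < n → Adjacent H (v (suc k)) (v k)) last →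
      nodes (outwardWalk n adj last) ≡ outward n
    nodes-outwardWalk zero    adj last = refl
    nodes-outwardWalk (suc n) adj last = cong (_ ∷_) (nodes-outwardWalk n _ last)

    outward-inner : ∀ {n j} (π : Walk H (v n) c) → nodes π ≡ outward n → suc j < n →
      Σ (Edge H (v (2 + j)) (v (suc j))) λ e → Σ (Edge H (v (suc j)) (v j)) λ f → Passes π e f
    outward-inner {n} {j} π eq j<n with outward-suffix j<n | outward-head j
    ... | xs , eq′ | ys , eq″ = nodes⇒passes π xs
      (trans eq (trans eq′ (cong (λ zs → xs ++ v (2 + j) ∷ v (suc j) ∷ zs) eq″)))

    outward-last : ∀ {n} (π : Walk H (v n) c) → nodes π ≡ outward n → 0 < n →
      Σ (Edge H (v 1) (v 0)) λ e → Σ (Edge H (v 0) c) λ f → Passes π e f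
    outward-last π eq 0<n with outward-suffix 0<n
    ... | xs , eq′ = nodes⇒passes π xs (trans eq eq′)

-- Walks of least weight

module _ {V : Set} {R : Rel V 0ℓ} where

  nodeAt : ∀ {a b} → Star R a b → ℕ → V
  nodeAt {a} w       zero    = a
  -- Beyond the end the last node is repeated.
  nodeAt {a} ε       (suc n) = a
  nodeAt     (_ ◅ w) (suc n) = nodeAt w n

  take : ∀ {a b} (w : Star R a b) n → Star R a (nodeAt w n)
  take w       zero    = ε
  take ε       (suc n) = ε
  take (e ◅ w) (suc n) = e ◅ take w n

  drop : ∀ {a b} (w : Star R a b) n → Star R (nodeAt w n) b
  drop w       zero    = w
  drop ε       (suc n) = ε
  drop (e ◅ w) (suc n) = drop w n

  nodeAt-length : ∀ {a b} (w : Star R a b) → nodeAt w (length w) ≡ b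
  nodeAt-length ε       = refl
  nodeAt-length (_ ◅ w) = nodeAt-length w

  stepAt : ∀ {a b} (w : Star R a b) {i} → i < length w → R (nodeAt w i) (nodeAt w (suc i))
  stepAt (e ◅ w) {zero}  _         = e
  stepAt (e ◅ w) {suc i} (s≤s i<m) = stepAt w i<m

  fromSteps : ∀ (u : ℕ → V) n → (∀ {i} → i < n → R (u i) (u (suc i))) → Star R (u 0) (u n)
  fromSteps u zero    step = ε
  fromSteps u (suc n) step = step (s≤s z≤n) ◅ fromSteps (u ∘ suc) n (step ∘ s≤s)

  module _ (δ : V → ℕ) where

    -- The number of steps plus `δ` of every node but the first. Leaving out nodes lowers it, and so
    -- does replacing nodes by a single one with smaller `δ`; one minimum thus serves both purposes.
    weight : ∀ {a b} → Star R a b → ℕ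
    weight ε                     = 0
    weight (_◅_ {j = v} e w) = suc (δ v + weight w)

    weight-◅◅ : ∀ {a b c} (w : Star R a b) (w′ : Star R b c) →
      weight (w ◅◅ w′) ≡ weight w + weight w′
    weight-◅◅ ε w′ = refl
    weight-◅◅ (_◅_ {j = v} e w) w′ =
      cong suc (trans (cong (δ v +_) (weight-◅◅ w w′)) (sym (+-assoc (δ v) (weight w) (weight w′))))

    weight-take-drop : ∀ {a b} (w : Star R a b) n → weight (take w n) + weight (drop w n) ≡ weight w
    weight-take-drop w       zero    = refl
    weight-take-drop ε       (suc n) = refl
    weight-take-drop (_◅_ {j = v} e w) (suc n) = cong suc
      (trans (+-assoc (δ v) (weight (take w n)) (weight (drop w n))) (cong (δ v +_) (weight-take-drop w n)))

    weight-drop : ∀ {a b} (w : Star R a b) {l r} → l < r → r ≤ length w →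
      suc (δ (nodeAt w r) + weight (drop w r)) ≤ weight (drop w l)
    weight-drop (e ◅ w) {zero}  {suc zero}    _         _         = ≤-refl
    weight-drop (_◅_ {j = v} e w) {zero} {suc (suc r)} _ (s≤s r≤) =
      ≤-trans (weight-drop w {zero} (s≤s z≤n) r≤) (m≤n⇒m≤1+n (m≤n+m (weight w) (δ v)))
    weight-drop (e ◅ w) {suc l} {suc r}       (s≤s l<r) (s≤s r≤) = weight-drop w l<r r≤

  record ShortestWalk (δ : V → ℕ) (x y : V) : Set where
    field
      m          : ℕ
      u          : ℕ → V
      starts     : u 0 ≡ x
      ends       : u m ≡ y
      step       : ∀ {i} → i < m → R (u i) (u (suc i))
      distinct   : ∀ {l r} → l < r → r ≤ m → u l ≢ u r
      noShortcut : ∀ {l r} → suc l < r → r ≤ m → ¬ R (u l) (u r)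
      noDetour   : ∀ {l i r d} → l < i → i < r → r ≤ m → R (u l) d → R d (u r) → ¬ δ d < δ (u i)

  shortestWalk : ExcludedMiddle 0ℓ → ∀ δ {x y} → Star R x y → ShortestWalk δ x y
  shortestWalk em δ {x} {y} w₀
    with Classical.least em {λ n → Σ (Star R x y) λ w → weight δ w ≡ n} (_ , w₀ , refl)
  ... | _ , (w , refl) , least = record
    { m          = length w
    ; u          = u
    ; starts     = refl
    ; ends       = nodeAt-length w
    ; step       = stepAt w
    ; distinct   = λ {l} {r} l<r r≤ eq → bypass l r (subst (Star R (u l)) eq ε)
        (≤-<-trans (≤-reflexive (cong (_+ weight δ (drop w r)) (weight-subst eq)))
          (<-≤-trans (s≤s (m≤n+m _ (δ (u r)))) (weight-drop δ w l<r r≤)))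
    ; noShortcut = λ {l} {r} l+1<r r≤ e → bypass l r (e ◅ ε)
        (<-≤-trans (s≤s (≤-reflexive (cong (_+ weight δ (drop w r)) (cong suc (+-identityʳ (δ (u r)))))))
          (≤-trans (s≤s (≤-trans (weight-drop δ w l+1<r r≤) (m≤n+m _ (δ (u (suc l))))))
            (weight-drop δ w (n<1+n l) (<⇒≤ (<-≤-trans l+1<r r≤)))))
    ; noDetour   = λ {l} {i} {r} {d} l<i i<r r≤ e f δd< → bypass l r (e ◅ f ◅ ε)
        (<-≤-trans (detour δd< (weight-drop δ w i<r r≤)) (weight-drop δ w l<i (<⇒≤ (<-≤-trans i<r r≤))))
    }
    where
    u : ℕ → V
    u = nodeAt w

    weight-subst : ∀ {a b} (eq : a ≡ b) → weight δ (subst (Star R a) eq ε) ≡ 0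
    weight-subst refl = refl

    bypass : ∀ l r (p : Star R (u l) (u r)) →
      weight δ p + weight δ (drop w r) < weight δ (drop w l) → ⊥
    bypass l r p lt = <⇒≱ lt (+-cancelˡ-≤ (weight δ (take w l)) _ _ (begin
      weight δ (take w l) + weight δ (drop w l)  ≡⟨ weight-take-drop δ w l ⟩
      weight δ w                                  ≤⟨ least (take w l ◅◅ p ◅◅ drop w r , refl) ⟩
      weight δ (take w l ◅◅ p ◅◅ drop w r)        ≡⟨ weight-◅◅ δ (take w l) _ ⟩
      weight δ (take w l) + weight δ (p ◅◅ drop w r)
        ≡⟨ cong (weight δ (take w l) +_) (weight-◅◅ δ p _) ⟩
      weight δ (take w l) + (weight δ p + weight δ (drop w r)) ∎))
      where
      open ≤-Reasoning

    -- Here `a`, `b`, `c` are the values of `δ` at the new node and at nodes `i` and `r`; `D` and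
    -- `W` are the weights of the suffixes from `r` and `i`.
    detour : ∀ {a b c D W} → a < b → suc (c + D) ≤ W →
      suc (a + suc (c + 0)) + D < suc (b + W)
    detour {a} {b} {c} {D} {W} a<b le = s≤s (begin
      suc (a + suc (c + 0) + D) ≡⟨ cong (λ n → suc (a + suc n + D)) (+-identityʳ c) ⟩
      suc (a + suc c + D)       ≡⟨ cong suc (+-assoc a (suc c) D) ⟩
      suc a + suc (c + D)       ≤⟨ +-mono-≤ a<b le ⟩
      b + W                     ∎)
      where
      open ≤-Reasoning

-- Stretches of colliders and the anterior distance

module _ {V : Set} (H : MixedGraph V) (v : ℕ → V) where

  -- Position `k` is that of node `k + 1`, which has a neighbour on either side for every `k`.
  CollidesAt : ℕ → Set
  CollidesAt k = Into H (v k) (v (1 + k)) × Into H (v (2 + k)) (v (1 + k))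

  -- For n > 0 a discriminating path v (n + 1), …, v 0, c for v 0, and for n = 0 an
  -- unshielded triple, up to the adjacency of consecutive nodes.
  record Stretch (c : V) (n : ℕ) : Set where
    constructor stretch
    field
      colliders : ∀ {k} → k < n → CollidesAt k × Directed H (v (1 + k)) c
      ¬adj      : ¬ Adjacent H (v (1 + n)) c

module Distance (em : ExcludedMiddle 0ℓ) {V : Set} (H : MixedGraph V) (T : Pred V 0ℓ) where
  open Classical em

  Reaches : V → ℕ → Set
  Reaches b k = ∃[ t ] t ∈ T × Σ (AnteriorWalk H b t) λ w → length w ≡ k

  -- 0 if there is no anterior walk from b to T.
  δ : V → ℕ
  δ b with em {∃ (Reaches b)}
  ... | yes r = proj₁ (least r)
  ... | no _  = 0

  δ-attained : ∀ {b} → b ∈ AntSet H T → Reaches b (δ b)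
  δ-attained {b} (t , t∈T , w) with em {∃ (Reaches b)}
  ... | yes r = proj₁ (proj₂ (least r))
  ... | no ¬r = contradiction (_ , t , t∈T , w , refl) ¬r

  δ-least : ∀ {b k} → Reaches b k → δ b ≤ k
  δ-least {b} r with em {∃ (Reaches b)}
  ... | yes r′ = proj₂ (proj₂ (least r′)) r
  ... | no ¬r  = z≤n

  δ-outOf : ∀ {b d} → OutOf H b d → d ∈ AntSet H T → δ b ≤ suc (δ d)
  δ-outOf out d∈ with δ-attained d∈
  ... | t , t∈T , w , eq = δ-least (t , t∈T , out ◅ w , cong suc eq)

  δ-step : ∀ {b} → b ∈ AntSet H T →
    b ∈ T ⊎ ∃[ d ] OutOf H b d × d ∈ AntSet H T × δ b ≡ suc (δ d)
  δ-step b∈ with δ-attained b∈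
  ... | _ , t∈T , ε , _ = inj₁ t∈T
  ... | t , t∈T , out ◅ w , eq = inj₂ (_ , out , d∈ ,
      ≤-antisym (δ-outOf out d∈) (≤-trans (s≤s (δ-least (t , t∈T , w , refl))) (≤-reflexive eq)))
    where
    d∈ : _ ∈ AntSet H T
    d∈ = t , t∈T , w

-- The walk w (n + 1), …, w 0 would be inducing.
outward-adjacent : ExcludedMiddle 0ℓ → ∀ {V : Set} {H : MixedGraph V} → IsσMAG H →
  (w : ℕ → V) (n : ℕ) → (∀ {j k} → j < k → k ≤ 1 + n → w j ≢ w k) →
  (∀ {k} → k ≤ n → Adjacent H (w (1 + k)) (w k)) →
  (∀ {k} → k < n → CollidesAt H w k × w (1 + k) ∈ AncSet H (｛ w (1 + n) ｝ ∪ ｛ w 0 ｝)) →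
  ¬ ¬ Adjacent H (w (1 + n)) (w 0)
outward-adjacent em {H = H} mag w n distinct adj colliding ¬adj =
    IsσMAG.maximal mag (distinct (s≤s z≤n) ≤-refl ∘ sym) ¬adj (π , record
      { isPath = isPath ; colliders = collides })
  where
  open MAG em mag
  open Outward (w ∘ suc) (w 0)

  π : Walk H (w (1 + n)) (w 0)
  π = outwardWalk n adj (adj z≤n)

  eq : nodes π ≡ outward n
  eq = nodes-outwardWalk n adj (adj z≤n)

  isPath : IsPath π
  isPath = subst Unique (sym eq) (outward-unique n
    (λ j<k k≤n → distinct (s≤s j<k) (s≤s k≤n)) (λ k≤n → distinct (s≤s z≤n) (s≤s k≤n) ∘ sym))

  at : ∀ {k} → k < n → Σ (Edge H (w (2 + k)) (w (1 + k))) λ e →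
    Σ (Edge H (w (1 + k)) (w k)) λ f → Passes π e f
  at {zero}  k<n = outward-last π eq k<n
  at {suc k} k<n = outward-inner π eq k<n

  collides : ∀ {u v v′} {e : Edge H u v} {f : Edge H v v′} → Passes π e f →
    Collider H e f × v ∈ AncSet H (｛ w (1 + n) ｝ ∪ ｛ w 0 ｝)
  collides {e = e} {f} p with ∈outward n (subst (_ ∈ˡ_) eq (middle∈nodes p))
  ... | inj₂ refl = contradiction refl (middle≢end isPath p)
  ... | inj₁ (k , k≤n , refl) with m≤n⇒m<n∨m≡n k≤n
  ...   | inj₂ refl = contradiction refl (middle≢start isPath p)
  ...   | inj₁ k<n with at k<n
  ...     | e′ , f′ , q with neighbours-unique isPath p q | colliding k<n
  ...       | refl , refl | (intoˡ , intoʳ) , anc =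
    (into⇒arrowhead e intoʳ , into⇒arrowhead (edge (MixedGraph.flip H (Edge.present f))) intoˡ) , anc

-- Transfer along unshielded triples and discriminating paths

module Transfer (em : ExcludedMiddle 0ℓ) {V : Set} {H₁ H₂ : MixedGraph V}
  (mag₁ : IsσMAG H₁) (mag₂ : IsσMAG H₂)
  (sameAdj : SameAdjacencies H₁ H₂) (sameUnsh : SameUnshieldedColliders H₁ H₂)
  (sameDisc : SameDiscriminatedColliders H₁ H₂) where

  open Classical em
  private
    module M₁ = MAG em mag₁
    module M₂ = MAG em mag₂

  adj₁⇒₂ : ∀ {a b} → Adjacent H₁ a b → Adjacent H₂ a b
  adj₁⇒₂ = Equivalence.to (sameAdj _ _)

  adj₂⇒₁ : ∀ {a b} → Adjacent H₂ a b → Adjacent H₁ a b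
  adj₂⇒₁ = Equivalence.from (sameAdj _ _)

  -- The stretch is given in full in `H₁`. In `H₂` only the collisions are assumed; the edges to `c`
  -- follow by `children₂`.
  record Ray (v : ℕ → V) (c : V) (n : ℕ) : Set where
    field
      adj      : ∀ {k} → k ≤ n → Adjacent H₁ (v (1 + k)) (v k)
      last     : Adjacent H₁ (v 0) c
      distinct : ∀ {j k} → j < k → k ≤ 1 + n → v j ≢ v k
      ≢c       : ∀ {k} → k ≤ 1 + n → v k ≢ c
      stretch₁ : Stretch H₁ v c n
      collide₂ : ∀ {k} → k < n → CollidesAt H₂ v k
    open Stretch stretch₁ public

  shorten : ∀ {v c n} → Ray v c (suc n) → Ray (v ∘ suc) c n
  shorten r = record
    { adj      = adj ∘ s≤s
    ; last     = edge (proj₂ (colliders (s≤s z≤n)))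
    ; distinct = λ j<k k≤ → distinct (s≤s j<k) (s≤s k≤)
    ; ≢c       = ≢c ∘ s≤s
    ; stretch₁ = stretch (colliders ∘ s≤s) ¬adj
    ; collide₂ = collide₂ ∘ s≤s
    }
    where
    open Ray r

  module _ {v : ℕ → V} {c : V} {n : ℕ}
    (distinct : ∀ {j k} → j < k → k ≤ 2 + n → v j ≢ v k) (≢c : ∀ {k} → k ≤ 2 + n → v k ≢ c)
    {H : MixedGraph V} (mag : IsσMAG H) (π : Walk H (v (2 + n)) c) where

    open Outward v c

    outward-discriminating : nodes π ≡ outward (2 + n) → Stretch H v c (suc n) →
      IsDiscriminatingPath H (v 0) π
    outward-discriminating eq (stretch colliders ¬adj) = record
      { isPath    = subst Unique (sym eq) (outward-unique (2 + n) distinct ≢c)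
      ; vs        = record { head = v (suc n) ; tail = inward n }
      ; shape     = trans eq (cong (v (2 + n) ∷_) (outward≡inward++ (suc n)))
      ; ¬adj      = ¬adj
      ; colliders = collide
      }
      where
      collide : ∀ w → w ∈ˡ inward (suc n) → IsColliderOn H w π × Directed H w c
      collide w w∈ with ∈inward (suc n) w∈
      ... | k , k<n , refl with outward-inner π eq (s≤s k<n) | colliders k<n
      ...   | e , f , p | (intoˡ , intoʳ) , d =
        (_ , _ , e , f , p , into⇒arrowhead e intoʳ , into⇒arrowhead (edge (flip (Edge.present f))) intoˡ) , d
        where
        open MAG em mag
        open MixedGraph H

    outward-collider : nodes π ≡ outward (2 + n) →
      IsColliderOn H (v 0) π ⇔ (Into H (v 1) (v 0) × Into H c (v 0))
    outward-collider eq with outward-last π eq (s≤s z≤n)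
    ... | e , f , p = mk⇔
      (λ (_ , _ , e′ , f′ , q , col) →
        case neighbours-unique (subst Unique (sym eq) (outward-unique (2 + n) distinct ≢c)) q p of λ where
          (refl , refl) → collider⇒into e′ f′ col)
      (λ (intoˡ , intoʳ) → _ , _ , e , f , p ,
        into⇒arrowhead e intoˡ , into⇒arrowhead (edge (flip (Edge.present f))) intoʳ)
      where
      open MAG em mag
      open MixedGraph H

  Children₂ : ∀ {v c n} → Ray v c n → Set
  Children₂ {v} {c} {n} _ = ∀ {k} → k < n → Directed H₂ (v (1 + k)) c

  -- For `n = 0` this is an unshielded triple, otherwise a discriminating path in both graphs. The
  -- primed lemmas assume `Children₂`, which `children₂` then supplies by induction.
  collider₁⇔₂′ : ∀ {n v c} (r : Ray v c n) → Children₂ r →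
    (Into H₁ (v 1) (v 0) × Into H₁ c (v 0)) ⇔ (Into H₂ (v 1) (v 0) × Into H₂ c (v 0))
  collider₁⇔₂′ {zero} {v} {c} r _ = mk⇔
    (λ cols → proj₂ (Equivalence.to   (sameUnsh _ _ _) (triple₁ , cols)))
    (λ cols → proj₂ (Equivalence.from (sameUnsh _ _ _) (triple₂ , cols)))
    where
    open Ray r
    triple₁ : UnshieldedTriple H₁ (v 1) (v 0) c
    triple₁ = record
      { a≢b = distinct ≤-refl ≤-refl ∘ sym ; b≢c = ≢c z≤n ; a≢c = ≢c ≤-refl
      ; adjˡ = adj ≤-refl ; adjʳ = last ; ¬adj = ¬adj }
    triple₂ : UnshieldedTriple H₂ (v 1) (v 0) c
    triple₂ = record
      { a≢b = distinct ≤-refl ≤-refl ∘ sym ; b≢c = ≢c z≤n ; a≢c = ≢c ≤-refl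
      ; adjˡ = adj₁⇒₂ (adj ≤-refl) ; adjʳ = adj₁⇒₂ last ; ¬adj = ¬adj ∘ adj₂⇒₁ }
  collider₁⇔₂′ {suc n} {v} {c} r ch = mk⇔
    (Equivalence.to (outward-collider distinct ≢c mag₂ π₂ eq₂) ∘ Equivalence.to same ∘
      Equivalence.from (outward-collider distinct ≢c mag₁ π₁ eq₁))
    (Equivalence.to (outward-collider distinct ≢c mag₁ π₁ eq₁) ∘ Equivalence.from same ∘
      Equivalence.from (outward-collider distinct ≢c mag₂ π₂ eq₂))
    where
    open Ray r
    open Outward v c
    adj₁ : ∀ {k} → k < 2 + n → Adjacent H₁ (v (1 + k)) (v k)
    adj₁ (s≤s k≤) = adj k≤
    π₁ : Walk H₁ (v (2 + n)) c
    π₁ = outwardWalk (2 + n) adj₁ last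
    π₂ : Walk H₂ (v (2 + n)) c
    π₂ = outwardWalk (2 + n) (adj₁⇒₂ ∘ adj₁) (adj₁⇒₂ last)
    eq₁ : nodes π₁ ≡ outward (2 + n)
    eq₁ = nodes-outwardWalk (2 + n) adj₁ last
    eq₂ : nodes π₂ ≡ outward (2 + n)
    eq₂ = nodes-outwardWalk (2 + n) (adj₁⇒₂ ∘ adj₁) (adj₁⇒₂ last)
    stretch₂ : Stretch H₂ v c (suc n)
    stretch₂ = stretch (λ k<n → collide₂ k<n , ch k<n) (¬adj ∘ adj₂⇒₁)
    same : IsColliderOn H₁ (v 0) π₁ ⇔ IsColliderOn H₂ (v 0) π₂
    same = sameDisc (v 0) π₁ π₂ (trans eq₁ (sym eq₂))
      (outward-discriminating distinct ≢c mag₁ π₁ eq₁ stretch₁)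
      (outward-discriminating distinct ≢c mag₂ π₂ eq₂ stretch₂)

  -- For `n = 0` σ-completeness would shield the triple. Otherwise `v 1 → c - v 0` is an anterior
  -- walk against the arrowhead at `v 1`.
  ¬undirected′ : ∀ {n v c} (r : Ray v c n) → Children₂ r → Into H₂ (v 1) (v 0) →
    ¬ Undirected H₂ (v 0) c
  ¬undirected′ {zero} r _ into u = Ray.¬adj r (adj₂⇒₁ (IsσMAG.complete₁ mag₂ into u))
  ¬undirected′ {suc n} r ch into u = M₂.anterior⇒¬into
    ((_ , ch (s≤s z≤n)) ◅ (_ , MixedGraph.flip H₂ u) ◅ ε)
    (proj₁ (Ray.collide₂ r (s≤s z≤n)))

  -- An arrowhead at `v 0` on the edge to `c` would make `v 0` a collider in `H₂`, hence in `H₁`,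
  -- where the edge has a tail there.
  child₂′ : ∀ {n v c} (r : Ray v c n) → Children₂ r → Directed H₁ (v 0) c → Into H₂ (v 1) (v 0) →
    Directed H₂ (v 0) c
  child₂′ r ch d₁ into with into⊎outOf H₂ (adj-sym H₂ (adj₁⇒₂ (Ray.last r)))
  ... | inj₁ into′ = contradiction (proj₂ (Equivalence.from (collider₁⇔₂′ r ch) (into , into′)))
    (M₁.anterior⇒¬into ((_ , d₁) ◅ ε))
  ... | inj₂ out with M₂.directed⊎undirected out
  ...   | inj₁ d₂ = d₂
  ...   | inj₂ u  = ⊥-elim (¬undirected′ r ch into u)

  -- The outer nodes come first: shortening the ray puts `v 1` in the place of `v 0`, when `v 2`,
  -- ..., `v n` are already parents of `c` in `H₂`.
  children₂ : ∀ {n v c} (r : Ray v c n) → Children₂ r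
  children₂ {suc n} r {zero} _ = child₂′ (shorten r) (children₂ (shorten r))
    (proj₂ (colliders (s≤s z≤n))) (proj₂ (collide₂ (s≤s z≤n)))
    where
    open Ray r
  children₂ {suc n} r {suc k} (s≤s k<n) = children₂ (shorten r) k<n

  collider₁⇔₂ : ∀ {n v c} → Ray v c n →
    (Into H₁ (v 1) (v 0) × Into H₁ c (v 0)) ⇔ (Into H₂ (v 1) (v 0) × Into H₂ c (v 0))
  collider₁⇔₂ r = collider₁⇔₂′ r (children₂ r)

  child₂ : ∀ {n v c} → Ray v c n → Directed H₁ (v 0) c → Into H₂ (v 1) (v 0) →
    Directed H₂ (v 0) c
  child₂ r = child₂′ r (children₂ r)

  ¬undirected : ∀ {n v c} → Ray v c n → Into H₂ (v 1) (v 0) → ¬ Undirected H₂ (v 0) c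
  ¬undirected r = ¬undirected′ r (children₂ r)

  -- The two sides of a node on a shortest open walk

  module _ (Z T : Pred V 0ℓ) where

    private
      Open₁ : V → V → Set
      Open₁ = OpenEdge H₁ Z (ArrowAnt H₁ T)

    record Arm (v : ℕ → V) (N : ℕ) : Set where
      field
        step     : ∀ {k} → k < N → Open₁ (v k) (v (1 + k))
        distinct : ∀ {j k} → j < k → k ≤ N → v j ≢ v k
        end∉Z    : v N ∉ Z

    -- A shortest open walk seen from an inner node, with indices increasing outwards on both arms;
    -- `swap` then exchanges left and right.
    record Fork (v v′ : ℕ → V) (N N′ : ℕ) : Set where
      field
        armˡ       : Arm v N
        armʳ       : Arm v′ N′
        0<N        : 0 < N
        0<N′       : 0 < N′
        meet       : v 0 ≡ v′ 0
        apart      : ∀ {j k} → j ≤ N → k ≤ N′ → 0 < j + k → v j ≢ v′ k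
        noShortcut : ∀ {j k} → j < N → k < N′ → ¬ Open₁ (v (1 + j)) (v′ (1 + k))

      last : Open₁ (v 0) (v′ 1)
      last = subst (λ b → Open₁ b (v′ 1)) (sym meet) (Arm.step armʳ 0<N′)

    swap : ∀ {v v′ N N′} → Fork v v′ N N′ → Fork v′ v N′ N
    swap fork = record
      { armˡ = armʳ ; armʳ = armˡ ; 0<N = 0<N′ ; 0<N′ = 0<N ; meet = sym meet
      ; apart = λ {j} {k} j≤ k≤ pos → apart k≤ j≤ (subst (0 <_) (+-comm j k) pos) ∘ sym
      ; noShortcut = λ j< k< → noShortcut k< j< ∘ openEdge-sym H₁
      }
      where
      open Fork fork

    module _ {v : ℕ → V} {N : ℕ} (arm : Arm v N) {c : V} (c∈A : c ∈ ArrowAnt H₁ T) where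
      open Arm arm

      StretchFrom : ℕ → Set
      StretchFrom k = ∃[ n ] k ≤ n × n < N × ¬ Adjacent H₁ (v (1 + n)) c ×
        (∀ {j} → k ≤ j → j < n → CollidesAt H₁ v j × Directed H₁ (v (1 + j)) c)

      Shortcut : Set
      Shortcut = ∃[ n ] n < N × Open₁ (v (1 + n)) c

      -- The arrowhead at `c` is forced by `into-child`. So an edge to `c` is open unless it has a
      -- tail at a node of `Z`, and then it is directed.
      reach-step : ∀ {k} → k < N → Into H₁ (v (1 + k)) (v k) → Directed H₁ (v k) c →
        ¬ Adjacent H₁ (v (1 + k)) c ⊎ Open₁ (v (1 + k)) c ⊎
        (v (1 + k) ∈ Z × Directed H₁ (v (1 + k)) c)
      reach-step {k} k<N into dir with em {Adjacent H₁ (v (1 + k)) c}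
      ... | no ¬adj = inj₁ ¬adj
      ... | yes adj with into⊎outOf H₁ (adj-sym H₁ adj) | em {v (1 + k) ∈ Z}
      ...   | inj₁ into′ | _ = inj₂ (inj₁
        (openEdge adj (λ _ → into′) (λ _ → M₁.into-child into dir adj) (OpenEdge.inᴴʳ (step k<N)) c∈A))
      ...   | inj₂ out | no ∉Z = inj₂ (inj₁
        (openEdge adj (⊥-elim ∘ ∉Z) (λ _ → M₁.into-child into dir adj) (OpenEdge.inᴴʳ (step k<N)) c∈A))
      ...   | inj₂ out | yes ∈Z =
        inj₂ (inj₂ (∈Z , M₁.into+outOf⇒directed (M₁.into-child into dir adj) out))

      prepend : ∀ {k} → CollidesAt H₁ v k → Directed H₁ (v (1 + k)) c →
        StretchFrom (1 + k) → StretchFrom k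
      prepend {k} col dir (n , k<n , n<N , ¬adj , cols) = n , <⇒≤ k<n , n<N , ¬adj , cols′
        where
        cols′ : ∀ {j} → k ≤ j → j < n → CollidesAt H₁ v j × Directed H₁ (v (1 + j)) c
        cols′ k≤j j<n with m≤n⇒m<n∨m≡n k≤j
        ... | inj₁ k<j  = cols k<j j<n
        ... | inj₂ refl = col , dir

      -- Walking outwards, the nodes remain parents of c until a non-neighbour of c
      -- or an open edge to c is found.
      reach : ∀ d k → suc k + d ≡ N → Into H₁ (v (1 + k)) (v k) → Directed H₁ (v k) c →
        StretchFrom k ⊎ Shortcut
      reach d k eq into dir
        with m+n≤o⇒m≤o (suc k) (≤-reflexive eq)
      ... | k<N with reach-step k<N into dir
      ...   | inj₁ ¬adj = inj₁ (k , ≤-refl , k<N , ¬adj , λ k≤j j<k → contradiction k≤j (<⇒≱ j<k))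
      ...   | inj₂ (inj₁ open₁) = inj₂ (k , k<N , open₁)
      -- At the outer end of the arm the third case fails, as the end is not in `Z`.
      reach zero k eq into dir | k<N | inj₂ (inj₂ (∈Z , _)) =
        contradiction (subst (λ n → v n ∈ Z) (trans (sym (+-identityʳ (suc k))) eq) ∈Z) end∉Z
      reach (suc d) k eq into dir | k<N | inj₂ (inj₂ (∈Z , dir′)) =
        Sum.map₁ (prepend (OpenEdge.arrowʳ (step k<N) ∈Z , into′) dir′)
          (reach d (suc k) eq′ into′ dir′)
        where
        eq′ : suc (suc k) + d ≡ N
        eq′ = trans (sym (+-suc (suc k) d)) eq
        into′ : Into H₁ (v (2 + k)) (v (1 + k))
        into′ = OpenEdge.arrowˡ (step (m+n≤o⇒m≤o (2 + k) (≤-reflexive eq′))) ∈Z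

    StretchIn : (ℕ → V) → ℕ → V → Set
    StretchIn v N c = ∃[ n ] n < N × Stretch H₁ v c n

    reach₀ : ∀ {v N c} → Arm v N → c ∈ ArrowAnt H₁ T → 0 < N →
      Into H₁ (v 1) (v 0) → Directed H₁ (v 0) c → StretchIn v N c ⊎ ∃[ n ] n < N × Open₁ (v (1 + n)) c
    reach₀ {N = suc N} arm c∈A _ into dir = Sum.map₁
      (λ (n , _ , n<N , ¬adj , cols) → n , n<N , stretch (cols z≤n) ¬adj)
      (reach arm c∈A N 0 refl into dir)

    -- A directed edge `v 1 → v′ 1` starts `reach` one node further out. An undirected one would
    -- give an open edge from `v 2` to `v′ 1` by σ-completeness, which is a shortcut.
    outOf-stretch : ∀ {v v′ N N′} → Fork v v′ N N′ →
      v 1 ∈ Z → OutOf H₁ (v 1) (v′ 1) → StretchIn v N (v′ 1)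
    outOf-stretch {N = suc zero} fork ∈Z out = contradiction ∈Z (Arm.end∉Z (Fork.armˡ fork))
    outOf-stretch {v} {v′} {N = suc (suc N)} fork ∈Z out
        with M₁.directed⊎undirected out
    ... | inj₁ dir with reach (Fork.armˡ fork) (OpenEdge.inᴴʳ (Fork.last fork)) N 1 refl
                          (OpenEdge.arrowˡ (Arm.step (Fork.armˡ fork) (s≤s (s≤s z≤n))) ∈Z) dir
    ...   | inj₂ (n , n<N , open₁) = contradiction open₁ (Fork.noShortcut fork n<N (Fork.0<N′ fork))
    ...   | inj₁ st with prepend (Fork.armˡ fork) (OpenEdge.inᴴʳ (Fork.last fork))
                           (OpenEdge.arrowʳ (Arm.step (Fork.armˡ fork) (s≤s z≤n)) ∈Z ,
                            OpenEdge.arrowˡ (Arm.step (Fork.armˡ fork) (s≤s (s≤s z≤n))) ∈Z) dir st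
    ...     | n , _ , n<N , ¬adj , cols = n , n<N , stretch (cols z≤n) ¬adj
    outOf-stretch {v} {v′} {N = suc (suc N)} fork ∈Z out | inj₂ und =
        contradiction shortcut (Fork.noShortcut fork (s≤s (s≤s z≤n)) (Fork.0<N′ fork))
      where
      open OpenEdge (Arm.step (Fork.armˡ fork) {1} (s≤s (s≤s z≤n)))
      into : Into H₁ (v 2) (v 1)
      into = arrowˡ ∈Z
      shortcut : Open₁ (v 2) (v′ 1)
      shortcut = openEdge (IsσMAG.complete₁ mag₁ into und)
        (λ v2∈Z → M₁.undirected-into into und (arrowʳ v2∈Z))
        (λ _ → M₁.into-undirected into und) inᴴʳ (OpenEdge.inᴴʳ (Fork.last fork))

    -- If `v 1` and `v′ 1` are adjacent, the edge is no shortcut. So it has a tail at one of them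
    -- that lies in `Z`, and the stretch grows on that side.
    stretchˡ⊎ʳ : ∀ {v v′ N N′} → Fork v v′ N N′ → StretchIn v N (v′ 1) ⊎ StretchIn v′ N′ (v 1)
    stretchˡ⊎ʳ {v} {v′} fork with em {Adjacent H₁ (v 1) (v′ 1)}
    ... | no ¬adj = inj₁ (0 , Fork.0<N fork , stretch (λ ()) ¬adj)
    ... | yes adj with em {v 1 ∈ Z × OutOf H₁ (v 1) (v′ 1)} | em {v′ 1 ∈ Z × OutOf H₁ (v′ 1) (v 1)}
    ...   | yes (∈Z , out) | _  = inj₁ (outOf-stretch fork ∈Z out)
    ...   | no _ | yes (∈Z , out) = inj₂ (outOf-stretch (swap fork) ∈Z out)
    ...   | no ¬out | no ¬out′ = contradiction
        (openEdge adj
          (λ ∈Z → [ id , (λ out → contradiction (∈Z , out) ¬out) ]′ (into⊎outOf H₁ (adj-sym H₁ adj)))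
          (λ ∈Z → [ id , (λ out → contradiction (∈Z , out) ¬out′) ]′ (into⊎outOf H₁ adj))
          (OpenEdge.inᴴʳ (Arm.step armˡ 0<N)) (OpenEdge.inᴴʳ last))
        (noShortcut 0<N 0<N′)
      where
      open Fork fork

    AgreesOn : (ℕ → V) → ℕ → Set
    AgreesOn v n = ∀ {k} → k < n → CollidesAt H₁ v k → CollidesAt H₂ v k

    ray : ∀ {v N c n} → Arm v N → (∀ {k} → k ≤ 1 + n → v k ≢ c) → Adjacent H₁ (v 0) c →
      n < N → Stretch H₁ v c n → AgreesOn v n → Ray v c n
    ray arm ≢c last n<N st agrees = record
      { adj      = λ k≤n → adj-sym H₁ (OpenEdge.adjacent (Arm.step arm (<-≤-trans (s≤s k≤n) n<N)))
      ; last     = last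
      ; distinct = λ j<k k≤ → Arm.distinct arm j<k (≤-trans k≤ n<N)
      ; ≢c       = ≢c
      ; stretch₁ = st
      ; collide₂ = λ k<n → agrees k<n (proj₁ (Stretch.colliders st k<n))
      }

    forkRay : ∀ {v v′ N N′} → Fork v v′ N N′ → ∀ {n} → n < N → Stretch H₁ v (v′ 1) n →
      AgreesOn v n → Ray v (v′ 1) n
    forkRay {v} fork n<N =
      ray armˡ (λ {k} k≤ → apart (≤-trans k≤ n<N) 0<N′ (m≤n+m 1 k)) (OpenEdge.adjacent last) n<N
      where
      open Fork fork

    -- A stretch on the left gives a ray for `¬undirected`. One on the right contradicts
    -- σ-completeness or makes `v 0 - v′ 1 → v 1` an anterior walk against the arrowhead at `v 0`.
    -- An arm of length `N` has `pred N` inner positions.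
    ¬into-undirected : ∀ {v v′ N N′} → Fork v v′ N N′ → AgreesOn v (pred N) → AgreesOn v′ (pred N′) →
      Into H₂ (v 1) (v 0) → ¬ Undirected H₂ (v 0) (v′ 1)
    ¬into-undirected {v} {v′} {suc N} {suc N′} fork agreesˡ agreesʳ into und with stretchˡ⊎ʳ fork
    ... | inj₁ (n , n<N , st) =
      ¬undirected (forkRay fork n<N st (λ k<n → agreesˡ (<-≤-trans k<n (s≤s⁻¹ n<N)))) into und
    ... | inj₂ (zero , n<N , st) =
      Stretch.¬adj st (adj₂⇒₁ (adj-sym H₂ (IsσMAG.complete₁ mag₂ into und)))
    ... | inj₂ (suc n , n<N , st) =
      M₂.anterior⇒¬into ((_ , und) ◅ (_ , children₂ r (s≤s z≤n)) ◅ ε) into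
      where
      r : Ray v′ (v 1) (suc n)
      r = forkRay (swap fork) n<N st (λ k<n → agreesʳ (<-≤-trans k<n (s≤s⁻¹ n<N)))

    open Distance em H₁ T

    -- Let `e` follow `d` on a shortest anterior walk to `T`. An edge between `b` and `e` would
    -- violate ancestrality or the minimality of `δ b`, so `b`, `d`, `e` is unshielded. Hence
    -- `d → e` is directed by σ-completeness and passes to `H₂` by `child₂`.
    descent : ∀ n {b d} → δ d ≡ n → Directed H₁ b d → Directed H₂ b d → d ∈ AntSet H₁ T →
      δ b ≡ suc (δ d) → d ∈ AntSet H₂ T
    descent n {b} {d} eq b→₁d b→₂d d∈ δb with δ-step d∈
    ... | inj₁ d∈T = d , d∈T , ε
    ... | inj₂ (e , out , e∈ , δd) = next n eq (M₁.directed⊎undirected out)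
      where
      ¬adj : ¬ Adjacent H₁ b e
      ¬adj adj with into⊎outOf H₁ (adj-sym H₁ adj)
      ... | inj₁ into = M₁.anterior⇒¬into ((_ , b→₁d) ◅ out ◅ ε) into
      ... | inj₂ out′ = <⇒≱ (≤-reflexive (sym δb)) (≤-trans (δ-outOf out′ e∈) (≤-reflexive (sym δd)))

      v : ℕ → V
      v zero    = d
      v (suc _) = b

      b≢d : b ≢ d
      b≢d = M₁.adjacent⇒≢ (edge b→₁d)

      r : Ray v e 0
      r = record
        { adj      = λ { z≤n → edge b→₁d }
        ; last     = M₁.outOf⇒adjacent out
        ; distinct = λ { {zero} {suc zero} _ _ → b≢d ∘ sym
                       ; {suc _} {suc zero} (s≤s ()) _ ; {_} {suc (suc _)} _ (s≤s ()) }
        ; ≢c       = λ { {zero} _ → M₁.adjacent⇒≢ (M₁.outOf⇒adjacent out)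
                       ; {suc _} _ refl → <⇒≱ (≤-reflexive (sym δb)) (≤-trans (n≤1+n _) (≤-reflexive (sym δd))) }
        ; stretch₁ = stretch (λ ()) ¬adj
        ; collide₂ = λ ()
        }

      next : ∀ n → δ d ≡ n → Directed H₁ d e ⊎ Undirected H₁ d e → d ∈ AntSet H₂ T
      next n eq (inj₂ und) = contradiction (IsσMAG.complete₁ mag₁ (_ , b→₁d) und) ¬adj
      next zero eq (inj₁ _) = contradiction (trans (sym eq) δd) λ ()
      next (suc n) eq (inj₁ d→₁e)
        with descent n (suc-injective (trans (sym δd) eq)) d→₁e
               (child₂ r d→₁e (_ , b→₂d)) e∈ δd
      ... | t , t∈T , w = t , t∈T , (_ , child₂ r d→₁e (_ , b→₂d)) ◅ w

    -- Let `d` follow `v 0` on a shortest anterior walk to `T`. If both arms have an open edge to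
    -- `d`, as when `v 0 - d`, then `d` is a detour closer to `T`. Otherwise one arm has a stretch,
    -- which carries `v 0 → d` over to `H₂`, and `descent` does the rest.
    collider∈AntSet₂ : ∀ {v v′ N N′} → Fork v v′ N N′ →
      (∀ {j k d} → j < N → k < N′ → Open₁ (v (1 + j)) d → Open₁ d (v′ (1 + k)) → ¬ δ d < δ (v 0)) →
      AgreesOn v (pred N) → AgreesOn v′ (pred N′) →
      Into H₁ (v 1) (v 0) → Into H₁ (v′ 1) (v′ 0) →
      Into H₂ (v 1) (v 0) → Into H₂ (v′ 1) (v′ 0) → v 0 ∈ AntSet H₂ T
    collider∈AntSet₂ {v} {v′} {N} {N′} fork noDetour agreesˡ agreesʳ intoˡ intoʳ into₂ˡ into₂ʳ
        with δ-step (OpenEdge.inᴴˡ (Arm.step armˡ 0<N) (_ , intoˡ))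
      where
      open Fork fork
    ... | inj₁ v0∈T = v 0 , v0∈T , ε
    ... | inj₂ (d , out , d∈ , δv0) = result
      where
      open Fork fork

      δd<δv0 : δ d < δ (v 0)
      δd<δv0 = ≤-reflexive (sym δv0)

      replace : ∀ {v N} → Arm v N → 0 < N → Into H₁ (v 1) (v 0) → Undirected H₁ (v 0) d → Open₁ (v 1) d
      replace arm 0<N into und = openEdge (IsσMAG.complete₁ mag₁ into und)
        (λ v1∈Z → M₁.undirected-into into und (OpenEdge.arrowʳ (Arm.step arm 0<N) v1∈Z))
        (λ _ → M₁.into-undirected into und) (OpenEdge.inᴴʳ (Arm.step arm 0<N)) (λ _ → d∈)

      along : ∀ {v N} → Arm v N → AgreesOn v (pred N) → Into H₁ (v 1) (v 0) → Into H₂ (v 1) (v 0) →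
        Directed H₁ (v 0) d → StretchIn v N d → Directed H₂ (v 0) d
      along {v} {suc N} arm agrees into into₂ dir (n , n<N , st@(stretch cols _)) =
        child₂ (ray arm ≢d (edge dir) n<N st (λ k<n → agrees (<-≤-trans k<n (s≤s⁻¹ n<N)))) dir into₂
        where
        child : ∀ {k} → k ≤ n → Directed H₁ (v k) d
        child {zero}  _   = dir
        child {suc k} k<n = proj₂ (cols k<n)
        into-at : ∀ {k} → k ≤ n → Into H₁ (v (1 + k)) (v k)
        into-at {zero}  _   = into
        into-at {suc k} k<n = proj₂ (proj₁ (cols k<n))
        -- Nodes up to `v n` are parents of `d`. If `d` were `v (1 + n)`, then `v n → d` would
        -- contradict the arrowhead at `v n`.
        ≢d : ∀ {k} → k ≤ 1 + n → v k ≢ d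
        ≢d {k} k≤ with m≤n⇒m<n∨m≡n k≤
        ... | inj₁ k<1+n = M₁.adjacent⇒≢ (edge (child (s≤s⁻¹ k<1+n)))
        ... | inj₂ refl  = λ { refl → M₁.anterior⇒¬into ((_ , child ≤-refl) ◅ ε) (into-at ≤-refl) }

      descend₂ : Directed H₁ (v 0) d → Directed H₂ (v 0) d → v 0 ∈ AntSet H₂ T
      descend₂ dir dir₂ with descent (δ d) refl dir dir₂ d∈ δv0
      ... | t , t∈T , w = t , t∈T , (_ , dir₂) ◅ w

      result : v 0 ∈ AntSet H₂ T
      result with M₁.directed⊎undirected out
      ... | inj₂ und = contradiction δd<δv0 (noDetour 0<N 0<N′ (replace armˡ 0<N intoˡ und)
        (openEdge-sym H₁ (replace armʳ 0<N′ intoʳ (subst (λ b → Undirected H₁ b d) meet und))))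
      ... | inj₁ dir with reach₀ armˡ (λ _ → d∈) 0<N intoˡ dir
      ...   | inj₁ st = descend₂ dir (along armˡ agreesˡ intoˡ into₂ˡ dir st)
      ...   | inj₂ (_ , j<N , openˡ)
        with reach₀ armʳ (λ _ → d∈) 0<N′ intoʳ (subst (λ b → Directed H₁ b d) meet dir)
      ...     | inj₁ st = descend₂ dir (subst (λ b → Directed H₂ b d) (sym meet)
        (along armʳ agreesʳ intoʳ into₂ʳ (subst (λ b → Directed H₁ b d) meet dir) st))
      ...     | inj₂ (_ , k<N′ , openʳ) =
        contradiction δd<δv0 (noDetour j<N k<N′ openˡ (openEdge-sym H₁ openʳ))

    -- Agreement of collider statuses along a shortest open walk

    module Transport {x y : V} (walk : ShortestWalk {R = Open₁} δ x y)
      (x∉Z : x ∉ Z) (y∉Z : y ∉ Z) where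

      open ShortestWalk walk

      -- Both arms start at node `p + 1`, the node of position `p`.
      leftArm rightArm : ℕ → ℕ → V
      leftArm  p k = u (suc p ∸ k)
      rightArm p k = u (k + suc p)

      1+m∸n : ∀ {m n} → n ≤ m → suc m ∸ n ≡ suc (m ∸ n)
      1+m∸n = +-∸-assoc 1

      right≤ : ∀ {p k} → 2 + p ≤ m → k ≤ m ∸ suc p → k + suc p ≤ m
      right≤ {p} {k} p≤ k≤ = m≤o∸n⇒m+n≤o k (≤-trans (n≤1+n _) p≤) k≤

      fork : ∀ p → 2 + p ≤ m → Fork (leftArm p) (rightArm p) (suc p) (m ∸ suc p)
      fork p p≤ = record
        { armˡ = record
          { step     = λ {k} k< → subst (λ n → Open₁ (u n) (u (p ∸ k))) (sym (1+m∸n (s≤s⁻¹ k<)))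
              (openEdge-sym H₁ (step (≤-trans (s≤s (m∸n≤m p k)) (<⇒≤ p≤))))
          ; distinct = λ {j} j<k k≤ → distinct (∸-monoʳ-< j<k k≤) (≤-trans (m∸n≤m (suc p) j) (<⇒≤ p≤)) ∘ sym
          ; end∉Z    = subst (_∉ Z) (sym (trans (cong u (n∸n≡0 p)) starts)) x∉Z
          }
        ; armʳ = record
          { step     = λ k< → step (right≤ p≤ k<)
          ; distinct = λ j<k k≤ → distinct (+-monoˡ-< (suc p) j<k) (right≤ p≤ k≤)
          ; end∉Z    = subst (_∉ Z) (sym (trans (cong u (m∸n+n≡m (<⇒≤ p≤))) ends)) y∉Z
          }
        ; 0<N        = s≤s z≤n
        ; 0<N′       = m<n⇒0<n∸m p≤
        ; meet       = refl
        ; apart      = λ {j} {k} j≤ k≤ pos → distinct (separate j k j≤ pos) (right≤ p≤ k≤)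
        ; noShortcut = λ {j} {k} j<N k<N′ → noShortcut
            (s≤s (≤-trans (s≤s (m∸n≤m p j)) (m≤n+m (suc p) k))) (right≤ p≤ k<N′)
        }
        where
        separate : ∀ j k → j ≤ suc p → 0 < j + k → suc p ∸ j < k + suc p
        separate zero    k j≤ pos = +-monoˡ-< (suc p) pos
        separate (suc j) k j≤ pos = ≤-trans (s≤s (m∸n≤m p j)) (m≤n+m (suc p) k)

      leftArm-collides : ∀ H {p k} → k < p →
        CollidesAt H (leftArm p) k ⇔ CollidesAt H u (p ∸ suc k)
      leftArm-collides H {p} {k} k<p = mk⇔
        (λ (a , b) → subst (Into H (u (p ∸ suc k)) ∘ u) eq b ,
                     subst₂ (λ i j → Into H (u i) (u j)) eq′ eq a)
        (λ (a , b) → subst₂ (λ i j → Into H (u i) (u j)) (sym eq′) (sym eq) b ,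
                     subst (Into H (u (p ∸ suc k)) ∘ u) (sym eq) a)
        where
        eq : p ∸ k ≡ suc (p ∸ suc k)
        eq = 1+m∸n k<p
        eq′ : suc p ∸ k ≡ suc (suc (p ∸ suc k))
        eq′ = trans (1+m∸n (<⇒≤ k<p)) (cong suc eq)

      Agree : ℕ → Set
      Agree p = CollidesAt H₁ u p ⇔ CollidesAt H₂ u p

      -- The collider status at position p, which is that of node p + 1, is determined
      -- by the positions between l and p, respectively between p and r.
      record DependsLeft (p : ℕ) : Set where
        field
          l      : ℕ
          l≤p    : l ≤ p
          facts  : ∀ {k} → l ≤ k → k < p → CollidesAt H₁ u k × Directed H₁ (u (1 + k)) (u (2 + p))
          ¬adj   : ¬ Adjacent H₁ (u l) (u (2 + p))
          decide : (∀ {k} → l ≤ k → k < p → Agree k) → Agree p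

      record DependsRight (p : ℕ) : Set where
        field
          r      : ℕ
          p+1<r  : 2 + p ≤ r
          r≤m    : r ≤ m
          facts  : ∀ {k} → p < k → suc k < r → CollidesAt H₁ u k × Directed H₁ (u (1 + k)) (u p)
          ¬adj   : ¬ Adjacent H₁ (u r) (u p)
          decide : (∀ {k} → p < k → suc k < r → Agree k) → Agree p

      depends : ∀ {p} → 2 + p ≤ m → DependsLeft p ⊎ DependsRight p
      depends {p} p≤ with stretchˡ⊎ʳ (fork p p≤)
      ... | inj₁ (n , n<N , st@(stretch cols ¬adj)) = inj₁ record
        { l      = p ∸ n
        ; l≤p    = m∸n≤m p n
        ; facts  = facts
        ; ¬adj   = ¬adj
        ; decide = λ agree → collider₁⇔₂ (forkRay (fork p p≤) n<N st λ {k} k<n →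
            let k<p = <-≤-trans k<n (s≤s⁻¹ n<N) in
            Equivalence.from (leftArm-collides H₂ k<p) ∘
            Equivalence.to (agree (∸-monoʳ-≤ p k<n) (∸-monoʳ-< (s≤s z≤n) k<p)) ∘
            Equivalence.to (leftArm-collides H₁ k<p))
        }
        where
        facts : ∀ {k} → p ∸ n ≤ k → k < p → CollidesAt H₁ u k × Directed H₁ (u (1 + k)) (u (2 + p))
        facts {k} l≤k k<p with cols (j<n k l≤k k<p)
          where
          j<n : ∀ k → p ∸ n ≤ k → k < p → p ∸ suc k < n
          j<n k l≤k k<p = ∸-cancelʳ-< (≤-<-trans l≤k (≤-reflexive (sym (m∸[m∸n]≡n k<p))))
        ... | col , dir = subst (CollidesAt H₁ u) eq (Equivalence.to (leftArm-collides H₁ j<p) col) ,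
          subst (λ i → Directed H₁ (u i) (u (2 + p))) (m∸[m∸n]≡n k<p) dir
          where
          j<p : p ∸ suc k < p
          j<p = ∸-monoʳ-< (s≤s z≤n) k<p
          eq : p ∸ suc (p ∸ suc k) ≡ k
          eq = suc-injective (trans (sym (1+m∸n j<p)) (m∸[m∸n]≡n k<p))
      ... | inj₂ (n , n<N , st@(stretch cols ¬adj)) = inj₂ record
        { r      = suc n + suc p
        ; p+1<r  = s≤s (m≤n+m (suc p) n)
        ; r≤m    = right≤ p≤ n<N
        ; facts  = λ {k} p<k k<r → subst
            (λ k → CollidesAt H₁ u k × Directed H₁ (u (1 + k)) (u p)) (m∸n+n≡m p<k)
            (cols (+-cancelʳ-< (suc p) _ _ (subst (_< n + suc p) (sym (m∸n+n≡m p<k)) (s≤s⁻¹ k<r))))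
        ; ¬adj   = ¬adj
        ; decide = decide
        }
        where
        decide : (∀ {k} → p < k → suc k < suc n + suc p → Agree k) → Agree p
        decide agree = mk⇔
            (Product.swap ∘ Equivalence.to same ∘ Product.swap)
            (Product.swap ∘ Equivalence.from same ∘ Product.swap)
          where
          same = collider₁⇔₂ (forkRay (swap (fork p p≤)) n<N st λ {k} k<n →
            Equivalence.to (agree (m≤n+m (suc p) k) (s≤s (+-monoˡ-< (suc p) k<n))))

      -- All inner nodes are colliders and parents of one of the ends, so the segment is an inducing
      -- path.
      adjacent-ends : ∀ d {j} → 2 + (d + j) ≤ m →
        (∀ {k} → j ≤ k → k ≤ d + j → CollidesAt H₁ u k ×
          (Directed H₁ (u (1 + k)) (u (2 + (d + j))) ⊎ Directed H₁ (u (1 + k)) (u j))) →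
        Adjacent H₁ (u (2 + (d + j))) (u j)
      adjacent-ends d {j} le facts = decidable-stable em
        (outward-adjacent em mag₁ (λ k → u (k + j)) (suc d)
          (λ j<k k≤ → distinct (+-monoˡ-< j j<k) (≤-trans (+-monoˡ-≤ j k≤) le))
          (λ k≤ → adj-sym H₁ (OpenEdge.adjacent (step (≤-trans (s≤s (+-monoˡ-≤ j k≤)) le))))
          λ {k} k< → map₂
            [ (λ d → _ , inj₁ refl , d ◅ ε) , (λ d → _ , inj₂ refl , d ◅ ε) ]′
            (facts (m≤n+m j k) (+-monoˡ-≤ j (s≤s⁻¹ k<))))

      -- If `l < j`, then `u (1 + i) → u j → u (2 + i)` goes against the arrowhead at `u (1 + i)`;
      -- if `2 + i < r`, then `u (1 + j) → u (2 + i) → u j` does so at `u (1 + j)`. If both are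
      -- equalities, the two stretches together form an inducing path between non-adjacent nodes.
      ¬mutual : ∀ {i j} → 2 + i ≤ m → j < i → (L : DependsLeft i) (R : DependsRight j) →
        DependsLeft.l L ≤ j → suc i < DependsRight.r R → ⊥
      ¬mutual {i} {j} i≤ j<i L R l≤j i<r with m≤n⇒m<n∨m≡n l≤j | m≤n⇒m<n∨m≡n i<r
      ... | inj₁ (s≤s l≤j′) | _ = M₁.anterior⇒¬into
          ((_ , proj₂ (R.facts j<i i<r)) ◅ (_ , proj₂ (L.facts l≤j′ (<-trans (n<1+n _) j<i))) ◅ ε)
          (proj₂ (proj₁ (R.facts j<i i<r)))
        where
        module L = DependsLeft L
        module R = DependsRight R
      ... | inj₂ refl | inj₁ i+2<r = M₁.anterior⇒¬into
          ((_ , proj₂ (L.facts ≤-refl j<i)) ◅ (_ , proj₂ (R.facts (m<n⇒m<1+n j<i) i+2<r)) ◅ ε)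
          (proj₁ (proj₁ (L.facts ≤-refl j<i)))
        where
        module L = DependsLeft L
        module R = DependsRight R
      ... | inj₂ refl | inj₂ i+2≡r = L.¬adj (adj-sym H₁ (subst (λ i → Adjacent H₁ (u (2 + i)) (u j)) i′+j≡i
          (adjacent-ends (i ∸ j) (subst (λ i → 2 + i ≤ m) (sym i′+j≡i) i≤)
            λ {k} j≤k k≤ → subst (λ i → CollidesAt H₁ u k ×
              (Directed H₁ (u (1 + k)) (u (2 + i)) ⊎ Directed H₁ (u (1 + k)) (u j)))
              (sym i′+j≡i) (facts j≤k (subst (k ≤_) i′+j≡i k≤)))))
        where
        module L = DependsLeft L
        module R = DependsRight R
        i′+j≡i : i ∸ j + j ≡ i
        i′+j≡i = m∸n+n≡m (<⇒≤ j<i)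
        facts : ∀ {k} → j ≤ k → k ≤ i → CollidesAt H₁ u k ×
          (Directed H₁ (u (1 + k)) (u (2 + i)) ⊎ Directed H₁ (u (1 + k)) (u j))
        facts j≤k k≤i with m≤n⇒m<n∨m≡n k≤i
        ... | inj₁ k<i  = map₂ inj₁ (L.facts j≤k k<i)
        ... | inj₂ refl = map₂ inj₂ (R.facts j<i i<r)

      Scanned : ℕ → Set
      Scanned n = (∀ {k} → k < n → Agree k) ⊎
        (∃[ j ] j < n × ¬ Agree j × DependsRight j × (∀ {k} → j < k → k < n → Agree k))

      -- As no two positions depend on each other, the last disagreement among the
      -- first n positions depends on positions to its right.
      scan : ∀ n → suc n ≤ m → Scanned n
      scan zero    _  = inj₁ λ ()
      scan (suc n) n< with em {Agree n} | scan n (<⇒≤ n<) | depends n<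
      ... | yes agree | inj₁ all | _ = inj₁ λ k<1+n → upto agree all k<1+n
        where
        upto : ∀ {k} → Agree n → (∀ {k} → k < n → Agree k) → k < suc n → Agree k
        upto agree all k<1+n with m≤n⇒m<n∨m≡n (s≤s⁻¹ k<1+n)
        ... | inj₁ k<n  = all k<n
        ... | inj₂ refl = agree
      ... | yes agree | inj₂ (j , j<n , ¬agree , R , after) | _ =
        inj₂ (j , m<n⇒m<1+n j<n , ¬agree , R , after′)
        where
        after′ : ∀ {k} → j < k → k < suc n → Agree k
        after′ j<k k<1+n with m≤n⇒m<n∨m≡n (s≤s⁻¹ k<1+n)
        ... | inj₁ k<n  = after j<k k<n
        ... | inj₂ refl = agree
      ... | no ¬agree | _ | inj₂ R =
        inj₂ (n , n<1+n n , ¬agree , R , λ n<k k<1+n → contradiction (s≤s⁻¹ k<1+n) (<⇒≱ n<k))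
      ... | no ¬agree | inj₁ all | inj₁ L = contradiction (DependsLeft.decide L λ _ → all) ¬agree
      ... | no ¬agree | inj₂ (j , j<n , ¬agree′ , R , after) | inj₁ L
        -- If `L` looks only at positions after `j`, or `R` only at positions before `n`, these
        -- agree and decide; otherwise the dependence is mutual.
        with ≤-<-connex (DependsLeft.l L) j | ≤-<-connex (DependsRight.r R) (suc n)
      ...   | inj₂ j<l | _ = contradiction (DependsLeft.decide L λ l≤k → after (<-≤-trans j<l l≤k)) ¬agree
      ...   | inj₁ _ | inj₁ r≤ =
        contradiction (DependsRight.decide R λ j<k k<r → after j<k (s≤s⁻¹ (<-≤-trans k<r r≤))) ¬agree′
      ...   | inj₁ l≤j | inj₂ <r = ⊥-elim (¬mutual n< j<n L R l≤j <r)

      -- A last disagreement on the whole walk would be decided by positions to its right, all of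
      -- which agree.
      agreement : ∀ {p} → 2 + p ≤ m → Agree p
      agreement {p} p≤ = go m refl p≤
        where
        go : ∀ n → n ≡ m → 2 + p ≤ n → Agree p
        go (suc n) refl p≤ with scan n ≤-refl
        ... | inj₁ all = all (s≤s⁻¹ p≤)
        ... | inj₂ (j , j<n , ¬agree , R , after) = contradiction
          (DependsRight.decide R λ j<k k<r → after j<k (s≤s⁻¹ (<-≤-trans k<r (DependsRight.r≤m R)))) ¬agree

      agreesˡ : ∀ {p} → 2 + p ≤ m → AgreesOn (leftArm p) p
      agreesˡ {p} p≤ {k} k<p = Equivalence.from (leftArm-collides H₂ k<p) ∘
        Equivalence.to (agreement (≤-trans (s≤s (s≤s (m∸n≤m p (suc k)))) p≤)) ∘
        Equivalence.to (leftArm-collides H₁ k<p)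

      agreesʳ : ∀ {p} → 2 + p ≤ m → AgreesOn (rightArm p) (pred (m ∸ suc p))
      agreesʳ {p} p≤ {k} k< = Equivalence.to (agreement (right≤ p≤ (k+1≤ (m ∸ suc p) k<)))
        where
        k+1≤ : ∀ n → k < pred n → suc (suc k) ≤ n
        k+1≤ (suc n) lt = s≤s lt

      -- Openness of the walk in `H₂`

      module _ (x∈T : x ∈ T) (y∈T : y ∈ T) where

        x∈AntSet : u 0 ∈ AntSet H₂ T
        x∈AntSet = subst (_∈ AntSet H₂ T) (sym starts) (x , x∈T , ε)

        y∈AntSet : ∀ {i} → i ≡ m → u i ∈ AntSet H₂ T
        y∈AntSet refl = subst (_∈ AntSet H₂ T) (sym ends) (y , y∈T , ε)

        collider∈ : ∀ {p} → 2 + p ≤ m → CollidesAt H₁ u p → u (1 + p) ∈ AntSet H₂ T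
        collider∈ {p} p≤ col@(intoˡ , intoʳ) = collider∈AntSet₂ (fork p p≤)
          (λ {j} {k} j<N k<N′ → noDetour (s≤s (m∸n≤m p j)) (s≤s (m≤n+m (suc p) k))
            (right≤ p≤ k<N′))
          (agreesˡ p≤) (agreesʳ p≤) intoˡ intoʳ (proj₁ col₂) (proj₂ col₂)
          where
          col₂ = Equivalence.to (agreement p≤) col

        -- Tails of `H₂` are followed towards `x` until `x` or a collider is met. Where an arrowhead
        -- stops them, the edge just taken cannot be undirected by `¬into-undirected`, so the node
        -- is a collider in both graphs.
        backward : ∀ p → 1 + p ≤ m → OutOf H₂ (u (1 + p)) (u p) → u p ∈ AntSet H₂ T
        backward zero    _  _   = x∈AntSet
        backward (suc p) p≤ out with em {CollidesAt H₁ u p} | into⊎outOf H₂ (adjacent₂ p≤)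
          where
          adjacent₂ : 2 + p ≤ m → Adjacent H₂ (u p) (u (1 + p))
          adjacent₂ p≤ = adj₁⇒₂ (OpenEdge.adjacent (step (<⇒≤ p≤)))
        ... | yes col | _ = collider∈ p≤ col
        ... | no _ | inj₂ out′ with backward p (<⇒≤ p≤) out′
        ...   | t , t∈T , w = t , t∈T , out′ ◅ w
        backward (suc p) p≤ out | no ¬col | inj₁ into with M₂.directed⊎undirected out
        ... | inj₁ dir = contradiction (Equivalence.from (agreement p≤) (into , (_ , dir))) ¬col
        ... | inj₂ und = contradiction (MixedGraph.flip H₂ und)
          (¬into-undirected (fork p p≤) (agreesˡ p≤) (agreesʳ p≤) into)

        forward : ∀ d p → 1 + p + d ≡ m → OutOf H₂ (u p) (u (1 + p)) → u (1 + p) ∈ AntSet H₂ T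
        forward zero    p eq _   = y∈AntSet (trans (sym (+-identityʳ (1 + p))) eq)
        forward (suc d) p eq out = go (em {CollidesAt H₁ u p}) (into⊎outOf H₂ adjacent₂)
            (M₂.directed⊎undirected out)
          where
          eq′ : 2 + p + d ≡ m
          eq′ = trans (sym (+-suc (1 + p) d)) eq
          p≤ : 2 + p ≤ m
          p≤ = m+n≤o⇒m≤o (2 + p) (≤-reflexive eq′)
          adjacent₂ : Adjacent H₂ (u (2 + p)) (u (1 + p))
          adjacent₂ = adj-sym H₂ (adj₁⇒₂ (OpenEdge.adjacent (step p≤)))
          go : Dec (CollidesAt H₁ u p) → Into H₂ (u (2 + p)) (u (1 + p)) ⊎ OutOf H₂ (u (1 + p)) (u (2 + p)) →
            Directed H₂ (u p) (u (1 + p)) ⊎ Undirected H₂ (u p) (u (1 + p)) → u (1 + p) ∈ AntSet H₂ T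
          go (yes col) _ _ = collider∈ p≤ col
          go (no _) (inj₂ out′) _ with forward d (1 + p) eq′ out′
          ... | t , t∈T , w = t , t∈T , out′ ◅ w
          go (no ¬col) (inj₁ into) (inj₁ dir) =
            contradiction (Equivalence.from (agreement p≤) ((_ , dir) , into)) ¬col
          go (no _) (inj₁ into) (inj₂ und) = contradiction (MixedGraph.flip H₂ und)
            (¬into-undirected (swap (fork p p≤)) (agreesʳ p≤) (agreesˡ p≤) into)

        -- A node with a tail is left along it until a collider or an end of the walk is met. Thus
        -- `ArrowAnt` in `H₁` becomes the full `AntSet` that the return to `G₂` requires.
        node∈ : ∀ {i} → i ≤ m → u i ∈ AntSet H₂ T
        node∈ {zero}  _  = x∈AntSet
        node∈ {suc p} i≤ with m≤n⇒m<n∨m≡n i≤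
        ... | inj₂ eq = y∈AntSet eq
        ... | inj₁ p≤ with into⊎outOf H₂ (adj₁⇒₂ (OpenEdge.adjacent (step i≤)))
                         | into⊎outOf H₂ (adj-sym H₂ (adj₁⇒₂ (OpenEdge.adjacent (step p≤))))
        ...   | inj₁ intoˡ | inj₁ intoʳ =
          collider∈ p≤ (Equivalence.from (agreement p≤) (intoˡ , intoʳ))
        ...   | inj₂ out | _ with backward p (<⇒≤ p≤) out
        ...     | t , t∈T , w = t , t∈T , out ◅ w
        node∈ {suc p} i≤ | inj₁ p≤ | inj₁ _ | inj₂ out
          with forward (m ∸ (2 + p)) (1 + p) (m+[n∸m]≡n p≤) out
        ... | t , t∈T , w = t , t∈T , out ◅ w

        openEdge₂ : ∀ {i} → i < m → OpenEdge H₂ Z (AntSet H₂ T) (u i) (u (1 + i))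
        openEdge₂ {i} i<m = openEdge (adj₁⇒₂ (OpenEdge.adjacent (step i<m)))
            (arrowˡ i i<m) arrowʳ (node∈ (<⇒≤ i<m)) (node∈ i<m)
          where
          collides₂ : ∀ {p} → 2 + p ≤ m → u (1 + p) ∈ Z → CollidesAt H₂ u p
          collides₂ p≤ ∈Z = Equivalence.to (agreement p≤)
            (OpenEdge.arrowʳ (step (<⇒≤ p≤)) ∈Z , OpenEdge.arrowˡ (step p≤) ∈Z)

          arrowˡ : ∀ i → i < m → u i ∈ Z → Into H₂ (u (1 + i)) (u i)
          arrowˡ zero    _   ∈Z = contradiction (subst (_∈ Z) starts ∈Z) x∉Z
          arrowˡ (suc p) p≤ ∈Z = proj₂ (collides₂ p≤ ∈Z)

          arrowʳ : u (1 + i) ∈ Z → Into H₂ (u i) (u (1 + i))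
          arrowʳ ∈Z with m≤n⇒m<n∨m≡n i<m
          ... | inj₁ p≤   = proj₁ (collides₂ p≤ ∈Z)
          ... | inj₂ refl = contradiction (subst (_∈ Z) ends ∈Z) y∉Z

        openWalk₂ : Star (OpenEdge H₂ Z (AntSet H₂ T)) x y
        openWalk₂ = subst₂ (Star (OpenEdge H₂ Z (AntSet H₂ T))) starts ends (fromSteps u m openEdge₂)

    openWalk₁⇒₂ : ∀ {x y} → x ∉ Z → y ∉ Z → x ∈ T → y ∈ T →
      Star Open₁ x y → Star (OpenEdge H₂ Z (AntSet H₂ T)) x y
    openWalk₁⇒₂ x∉Z y∉Z x∈T y∈T w = openWalk₂ x∈T y∈T
      where
      open Transport (shortestWalk em δ w) x∉Z y∉Z

-- The three conditions imply Markov equivalence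

module Backward (em : ExcludedMiddle 0ℓ) {V S : Set} {G₁ G₂ : DMG (V ⊎ S)} {H₁ H₂ : MixedGraph V}
  (mag₁ : IsσMAG H₁) (mag₂ : IsσMAG H₂) (rep₁ : Represents H₁ G₁) (rep₂ : Represents H₂ G₂)
  (sameAdj : SameAdjacencies H₁ H₂) (sameUnsh : SameUnshieldedColliders H₁ H₂)
  (sameDisc : SameDiscriminatedColliders H₁ H₂) where

  private
    module R₁ = Representation em rep₁
    module R₂ = Representation em rep₂
  open Transfer em mag₁ mag₂ sameAdj sameUnsh sameDisc

  -- A σ-open walk is carried from `G₁` to `H₁`, from there to `H₂`, and finally to `G₂`.
  separated₂⇒₁ : ∀ X Y Z → σSeparated G₂ (embed X) (embed Y) (embed Z ∪ 𝒮) →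
    σSeparated G₁ (embed X) (embed Y) (embed Z ∪ 𝒮)
  separated₂⇒₁ X Y Z sep {inj₁ x} {inj₁ y} x∈X y∈Y π open₁ = sep x∈X y∈Y (proj₁ openWalk) (proj₂ openWalk)
    where
    x∉ : inj₁ x ∉ R₁.W Z x y
    x∉ = IsσOpen.nonColliders open₁ start
    y∉ : inj₁ y ∉ R₁.W Z x y
    y∉ = IsσOpen.nonColliders open₁ end

    openWalk : Σ (Walk (DMG.graph G₂) (inj₁ x) (inj₁ y)) (IsσOpen G₂ (embed Z ∪ 𝒮))
    openWalk = nice⇒σOpen G₂ em x∉ y∉ (R₂.openWalk⇒connected Z x y
      (openWalk₁⇒₂ Z (R₁.T Z x y) (x∉ ∘ inj₁) (y∉ ∘ inj₁) (inj₂ (inj₁ refl)) (inj₂ (inj₂ refl))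
        (R₁.connected⇒openWalk Z x y (x∉ ∘ inj₁) (y∉ ∘ inj₁) (σOpen⇒nice G₁ em open₁))))

theorem4 : ExcludedMiddle 0ℓ →
    {V S : Set} (G₁ G₂ : DMG (V ⊎ S)) (H₁ H₂ : MixedGraph V) →
    IsσMAG H₁ → IsσMAG H₂ →
    Represents H₁ G₁ → Represents H₂ G₂ →
    σMarkovEquivalent G₁ G₂ ⇔
    (SameAdjacencies H₁ H₂ × SameUnshieldedColliders H₁ H₂ × SameDiscriminatedColliders H₁ H₂)
theorem4 em G₁ G₂ H₁ H₂ mag₁ mag₂ rep₁ rep₂ = mk⇔ to from
  where
  to : σMarkovEquivalent G₁ G₂ →
    SameAdjacencies H₁ H₂ × SameUnshieldedColliders H₁ H₂ × SameDiscriminatedColliders H₁ H₂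
  to equiv =
      (λ a b → mk⇔ F.adjacent₁⇒₂ F′.adjacent₁⇒₂) ,
      (λ a b c → mk⇔ (F.unshieldedCollider₁⇒₂ F′.adjacent₁⇒₂) (F′.unshieldedCollider₁⇒₂ F.adjacent₁⇒₂)) ,
      (λ v π π′ eq d d′ → mk⇔
        (F.discriminatedCollider₁⇒₂ F′.adjacent₁⇒₂ v π π′ eq d d′)
        (F′.discriminatedCollider₁⇒₂ F.adjacent₁⇒₂ v π′ π (sym eq) d′ d))
    where
    module F  = Forward em rep₁ rep₂ equiv
    module F′ = Forward em rep₂ rep₁ (λ X Y Z → ⇔-sym (equiv X Y Z))

  from : SameAdjacencies H₁ H₂ × SameUnshieldedColliders H₁ H₂ × SameDiscriminatedColliders H₁ H₂ →
    σMarkovEquivalent G₁ G₂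
  from (adj , unsh , disc) X Y Z = mk⇔
    (Backward.separated₂⇒₁ em mag₂ mag₁ rep₂ rep₁
      (λ a b → ⇔-sym (adj a b)) (λ a b c → ⇔-sym (unsh a b c))
      (λ v π′ π eq d′ d → ⇔-sym (disc v π π′ (sym eq) d d′)) X Y Z)
    (Backward.separated₂⇒₁ em mag₁ mag₂ rep₁ rep₂ adj unsh disc X Y Z)
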